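{- There is an absolute constant $c>0$ such that for all $k\ge 2$, $$2^{ck}\le R_3(\mathcal{B}(K_4),k)\le R(K_4^*,k)+1,$$ and moreover $R(K_4^*,k)\le e(1+o(1))(k-1)k!$ as $k\to\infty$.
   Context: For a graph $G$, a hypergraph $H$ is a Berge-$G$ hypergraph if there are an injective map $\phi:V(G)\to V(H)$ and pairwise distinct hyperedges $e_{xy}\in E(H)$, one for each $xy\in E(G)$, with $\phi(x),\phi(y)\in e_{xy}$. $\mathcal{B}(G)$ denotes the family of all Berge-$G$ hypergraphs. For a family $\mathcal{H}$ of $3$-uniform hypergraphs, $R_3(\mathcal{H},k)$ is the smallest $n$ such that every $k$-coloring of the hyperedges of the complete $3$-uniform hypergraph $K_n^3$ contains a monochromatic subhypergraph belonging to $\mathcal{H}$. For a family $\mathcal{G}$ of graphs, $R(\mathcal{G},k)$ is the smallest $n$ such that every $k$-coloring of the edges of $K_n$ contains a monochromatic subgraph isomorphic to some member of $\mathcal{G}$. $K_4^*$ is the family of graphs consisting of: $K_4$; the graph obtained from $K_4$ minus an edge by attaching a pendant edge at one of its two vertices of degree $2$; and the triangle with a pendant edge attached at each of its three vertices. (Equivalently, for a vertex $v$ of $K_4$ with neighbors $q_1,q_2,q_3$, $K_4^*$ is the family of graphs obtained from the triangle $K_4-v$ by adding, for each $i$, an edge $q_ir_i$ not in the triangle, with $r_i$ a vertex of the triangle or a new vertex, new vertices possibly shared, the three added edges pairwise distinct.) -}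

module Defs where

open import Level using (0ℓ)
open import Data.Nat.Base using (ℕ; zero; suc; _!) renaming (_^_ to _^ℕ_; _*_ to _*ℕ_; _≤_ to _≤ℕ_)
open import Data.Nat.Properties using (_!≢0)
open import Data.Integer.Base using (+_) renaming (∣_∣ to ∣_∣ℤ)
open import Data.Rational.Base using (ℚ; 0ℚ; 1ℚ; ↥_; ↧ₙ_; _/_; _+_; _<_; _≤_; ∣_∣)
open import Data.Fin.Base using (Fin)
open import Data.Fin.Patterns using (0F; 1F; 2F; 3F; 4F; 5F)
open import Data.Fin.Subset using (Subset; _∈_; _⊆_) renaming (∣_∣ to card)
open import Data.List.Base using (List; []; _∷_)
import Data.List.Membership.Propositional as List
open import Data.Product.Base using (Σ-syntax; ∃-syntax; _×_; _,_; proj₁)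
open import Data.Sum.Base using (_⊎_; swap)
open import Function.Definitions using (Injective)
open import Relation.Binary.Core using (Rel)
open import Relation.Binary.Definitions using (Symmetric)
open import Relation.Binary.PropositionalEquality.Core using (_≡_; _≢_; refl; sym; ≢-sym)
open import Relation.Nullary.Negation.Core using (¬_)

record Graph : Set₁ where
  field
    order  : ℕ
    Adj    : Rel (Fin order) 0ℓ
    symm   : Symmetric Adj
    irrefl : ∀ {x} → ¬ Adj x x

GraphFamily : Set₂
GraphFamily = Graph → Set₁

-- Finite hypergraphs whose vertices are among 0 , … , n - 1.
record Hypergraph (n : ℕ) : Set₁ where
  field
    V   : Subset n
    E   : Subset n → Set
    E⊆V : ∀ {s} → E s → s ⊆ V

HypergraphFamily : Set₂
HypergraphFamily = ∀ {n} → Hypergraph n → Set₁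

-- edge x y is the hyperedge assigned to the unordered pair xy; its value is
-- irrelevant unless x and y are adjacent.
record Berge (G : Graph) {n : ℕ} (H : Hypergraph n) : Set₁ where
  open Graph G
  open Hypergraph H
  field
    φ             : Fin order → Fin n
    φ∈V           : ∀ x → φ x ∈ V
    φ-injective   : Injective _≡_ _≡_ φ
    edge          : Fin order → Fin order → Subset n
    edge-sym      : ∀ x y → edge x y ≡ edge y x
    edge∈E        : ∀ {x y} → Adj x y → E (edge x y)
    φ∈edge        : ∀ {x y} → Adj x y → φ x ∈ edge x y × φ y ∈ edge x y
    edge-distinct : ∀ {x y z w} → Adj x y → Adj z w → edge x y ≡ edge z w →
                    (x ≡ z × y ≡ w) ⊎ (x ≡ w × y ≡ z)

-- The edges of the complete r-uniform hypergraph on n vertices.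
Edge : ℕ → ℕ → Set
Edge r n = Σ[ s ∈ Subset n ] card s ≡ r

Coloring : ℕ → ℕ → ℕ → Set
Coloring r n k = Edge r n → Fin k

MonoHypergraph : ∀ {r n k} → HypergraphFamily → Coloring r n k → Set₁
MonoHypergraph {r} {n} {k} 𝓗 c =
  Σ[ i ∈ Fin k ] Σ[ H ∈ Hypergraph n ]
    𝓗 H × (∀ s → Hypergraph.E H s → Σ[ p ∈ card s ≡ r ] c (s , p) ≡ i)

-- For φ x ≢ φ y, the edge e below is necessarily {φ x , φ y}.
MonoGraph : ∀ {n k} → GraphFamily → Coloring 2 n k → Set₁
MonoGraph {n} {k} 𝓖 c =
  Σ[ i ∈ Fin k ] Σ[ G ∈ Graph ] 𝓖 G ×
    (let open Graph G in
     Σ[ φ ∈ (Fin order → Fin n) ] Injective _≡_ _≡_ φ ×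
       (∀ {x y} → Adj x y →
          Σ[ e ∈ Edge 2 n ] φ x ∈ proj₁ e × φ y ∈ proj₁ e × c e ≡ i))

IsLeast : ∀ {ℓ} → (ℕ → Set ℓ) → ℕ → Set ℓ
IsLeast P n = P n × (∀ m → P m → n ≤ℕ m)

-- n = R₃(𝓗, k)
IsR₃ : HypergraphFamily → ℕ → ℕ → Set₁
IsR₃ 𝓗 k = IsLeast λ n → (c : Coloring 3 n k) → MonoHypergraph 𝓗 c

-- n = R(𝓖, k)
IsR : GraphFamily → ℕ → ℕ → Set₁
IsR 𝓖 k = IsLeast λ n → (c : Coloring 2 n k) → MonoGraph 𝓖 c

fromEdges : ∀ n → List (Fin n × Fin n) → Graph
fromEdges n es = record
  { order  = n
  ; Adj    = λ x y → x ≢ y × ((x , y) List.∈ es ⊎ (y , x) List.∈ es)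
  ; symm   = λ { (x≢y , e) → ≢-sym x≢y , swap e }
  ; irrefl = λ { (x≢x , _) → x≢x refl }
  }

complete : ℕ → Graph
complete n = record
  { order = n ; Adj = _≢_ ; symm = ≢-sym ; irrefl = λ x≢x → x≢x refl }

K₄ : Graph
K₄ = complete 4

-- K₄ minus the edge {0 , 1}, with a pendant edge {0 , 4}.
K₄⁻+pendant : Graph
K₄⁻+pendant = fromEdges 5
  ((0F , 2F) ∷ (0F , 3F) ∷ (1F , 2F) ∷ (1F , 3F) ∷ (2F , 3F) ∷ (0F , 4F) ∷ [])

-- The triangle on 0 , 1 , 2, with a pendant edge at each vertex.
triangle+pendants : Graph
triangle+pendants = fromEdges 6
  ((0F , 1F) ∷ (0F , 2F) ∷ (1F , 2F) ∷ (0F , 3F) ∷ (1F , 4F) ∷ (2F , 5F) ∷ [])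

K₄⋆ : GraphFamily
K₄⋆ G = G ≡ K₄ ⊎ G ≡ K₄⁻+pendant ⊎ G ≡ triangle+pendants

infix 4 2^[_·_]≤_ _≤lim_

-- 2^(ck) ≤ r for a rational c ≥ 0: with c = p/q, raise both sides to the power q.
2^[_·_]≤_ : ℚ → ℕ → ℕ → Set
2^[ c · k ]≤ r = 2 ^ℕ (∣ ↥ c ∣ℤ *ℕ k) ≤ℕ r ^ℕ ↧ₙ c

fromℕ : ℕ → ℚ
fromℕ n = + n / 1

-- e-sum m = Σ_{i ≤ m} 1/i!, which converges to e.
e-sum : ℕ → ℚ
e-sum zero    = 1ℚ
e-sum (suc m) = e-sum m + (+ 1 / (suc m !)) {{ suc m !≢0 }}

-- For a convergent sequence s of rationals: q is at most the real number lim s.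
_≤lim_ : ℚ → (ℕ → ℚ) → Set
q ≤lim s = ∀ ε → 0ℚ < ε → ∃[ M ] (∀ m → M ≤ℕ m → q ≤ s m + ε)

IsLittleO1 : (ℕ → ℚ) → Set
IsLittleO1 δ = ∀ ε → 0ℚ < ε → ∃[ K ] (∀ k → K ≤ℕ k → ∣ δ k ∣ < ε)

{-# OPTIONS --safe #-}

-- Lower bound. A 3-partite 3-graph contains no Berge-K₄: two of the four core
-- vertices lie in one part, and no hyperedge contains both. A random map to
-- three parts separates a given triple with probability 2/9, so by repeated
-- averaging k maps separate all triples of n points once n³ (7/9)^k < 1;
-- colouring a triple by a map that separates it, this gives
-- R₃(B(K₄), k)^9 ≥ (9/7)^(3k) ≥ 2^k.
--
-- R₃ ≤ R + 1. In the link of a vertex v, a member of K₄⋆ in colour i is a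
-- triangle with a further edge at each of its vertices; adding v to its six
-- edges gives the hyperedges of a Berge-K₄ with core v and the triangle.
--
-- Upper bound. Without a monochromatic member of K₄⋆, every monochromatic
-- triangle has a vertex of degree 2 in its colour, hence there are at most nk
-- of them on n vertices. Split the vertices at random into r parts with
-- r² ≥ 2k: on average at most n/2 of these triangles lie within a part, and
-- after deleting a vertex of each of them every part is free of monochromatic
-- triangles, so n ≤ 2 r k! Σ_{j ≤ k} 1/j!. For large k, r² ≥ 2k is compatible
-- with 2r ≤ k - 2, which is all the bound needs.
module Submission where

open import Defs

-- Averages over all maps from n points to r parts.

module Averaging where

  open import Data.Bool.Base using (true; false; if_then_else_)
  open import Data.Fin.Base using (Fin; zero; suc)
  open import Data.List.Base using (List; []; _∷_; length; filter; map; cartesianProduct)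
  open import Data.List.Properties using (length-++; length-map)
  open import Data.List.Relation.Unary.All using (All; []; _∷_)
  open import Data.Nat.Base using (ℕ; zero; suc; _+_; _*_; _^_; _≤_; z≤n; NonZero)
  open import Data.Nat.Properties
  open import Data.Nat.Tactic.RingSolver using (solve-∀)
  open import Data.Product.Base using (Σ-syntax; _×_; _,_; proj₁; proj₂)
  open import Data.Sum.Base using (inj₁; inj₂)
  open import Data.Vec.Base using (Vec; []; _∷_; lookup; _[_]≔_)
  open import Data.Vec.Properties using (lookup∘update; lookup∘update′)
  open import Function.Base using (_∘_)
  open import Relation.Binary.PropositionalEquality
    using (_≡_; _≢_; refl; sym; trans; cong; cong₂; module ≡-Reasoning)
  open import Relation.Nullary.Decidable.Core using (Dec; does)
  open import Algebra.Properties.Semiring.Sum +-*-semiring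
    using (sum-syntax; sum-cong-≗; ∑-distrib-+; ∑-comm; *-distribˡ-sum)

  ind : ∀ {p} {P : Set p} → Dec P → ℕ
  ind P? = if does P? then 1 else 0

  length-filter-∷ : ∀ {A : Set} {P : A → Set} (P? : ∀ x → Dec (P x)) x xs →
                    length (filter P? (x ∷ xs)) ≡ ind (P? x) + length (filter P? xs)
  length-filter-∷ P? x xs with does (P? x)
  ... | true  = refl
  ... | false = refl

  length-cartesianProduct : ∀ {A B : Set} (xs : List A) (ys : List B) →
                            length (cartesianProduct xs ys) ≡ length xs * length ys
  length-cartesianProduct []       ys = refl
  length-cartesianProduct (x ∷ xs) ys =
    trans (length-++ (map (x ,_) ys)) (cong₂ _+_ (length-map (x ,_) ys) (length-cartesianProduct xs ys))

  ∑-const : ∀ r c → ∑[ a < r ] c ≡ r * c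
  ∑-const zero    c = refl
  ∑-const (suc r) c = cong (c +_) (∑-const r c)

  ∃-minimum : ∀ r .{{_ : NonZero r}} (F : Fin r → ℕ) → Σ[ a ∈ Fin r ] r * F a ≤ ∑[ b < r ] F b
  ∃-minimum (suc zero)    F = zero , ≤-refl
  ∃-minimum (suc (suc r)) F with a , le ← ∃-minimum (suc r) (F ∘ suc) | ≤-total (F zero) (F (suc a))
  ... | inj₁ z≤a = zero , +-monoʳ-≤ (F zero) (≤-trans (*-monoʳ-≤ (suc r) z≤a) le)
  ... | inj₂ a≤z = suc a , +-mono-≤ a≤z le

  -- A map from n points to r parts is the vector of its values, so `∑Vec` is r^n times the
  -- expectation over a uniformly random map. Probabilities are kept as integers in this way.
  ∑Vec : ∀ {r} n → (Vec (Fin r) n → ℕ) → ℕ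
  ∑Vec     zero    F = F []
  ∑Vec {r} (suc n) F = ∑[ a < r ] ∑Vec n (F ∘ (a ∷_))

  module _ {r : ℕ} where

    ∑Vec-cong : ∀ n {F G : Vec (Fin r) n → ℕ} → (∀ f → F f ≡ G f) → ∑Vec n F ≡ ∑Vec n G
    ∑Vec-cong zero    F≗G = F≗G []
    ∑Vec-cong (suc n) F≗G = sum-cong-≗ λ a → ∑Vec-cong n (F≗G ∘ (a ∷_))

    ∑Vec-+ : ∀ n (F G : Vec (Fin r) n → ℕ) → ∑Vec n (λ f → F f + G f) ≡ ∑Vec n F + ∑Vec n G
    ∑Vec-+ zero    F G = refl
    ∑Vec-+ (suc n) F G =
      trans (sum-cong-≗ λ a → ∑Vec-+ n (F ∘ (a ∷_)) (G ∘ (a ∷_)))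
            (∑-distrib-+ (λ a → ∑Vec n (F ∘ (a ∷_))) (λ a → ∑Vec n (G ∘ (a ∷_))))

    ∑Vec-∑ : ∀ n m (F : Fin m → Vec (Fin r) n → ℕ) →
             ∑Vec n (λ f → ∑[ a < m ] F a f) ≡ ∑[ a < m ] ∑Vec n (F a)
    ∑Vec-∑ zero    m F = refl
    ∑Vec-∑ (suc n) m F =
      trans (sum-cong-≗ λ b → ∑Vec-∑ n m (λ a → F a ∘ (b ∷_)))
            (∑-comm {r} {m} (λ b a → ∑Vec n (F a ∘ (b ∷_))))

    ∑Vec-const : ∀ n c → ∑Vec {r} n (λ _ → c) ≡ r ^ n * c
    ∑Vec-const zero    c = sym (+-identityʳ c)
    ∑Vec-const (suc n) c = begin
      ∑[ a < r ] ∑Vec n (λ _ → c) ≡⟨ sum-cong-≗ {r} (λ _ → ∑Vec-const n c) ⟩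
      ∑[ a < r ] (r ^ n * c)      ≡⟨ ∑-const r _ ⟩
      r * (r ^ n * c)             ≡⟨ *-assoc r (r ^ n) c ⟨
      r * r ^ n * c               ∎
      where open ≡-Reasoning

    -- Every vector occurs exactly r times among the `f [ x ]≔ a`: redrawing one value of a uniform
    -- map leaves it uniform.
    ∑Vec-resample : ∀ n x (F : Vec (Fin r) n → ℕ) →
                    r * ∑Vec n F ≡ ∑Vec n (λ f → ∑[ a < r ] F (f [ x ]≔ a))
    ∑Vec-resample (suc n) zero F = begin
      r * ∑Vec (suc n) F                                  ≡⟨ ∑-const r _ ⟨
      ∑[ b < r ] ∑[ a < r ] ∑Vec n (F ∘ (a ∷_))          ≡⟨ sum-cong-≗ {r} (λ _ → ∑Vec-∑ n r (λ a → F ∘ (a ∷_))) ⟨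
      ∑[ b < r ] ∑Vec n (λ f → ∑[ a < r ] F (a ∷ f))     ∎
      where open ≡-Reasoning
    ∑Vec-resample (suc n) (suc x) F = begin
      r * ∑[ b < r ] ∑Vec n (F ∘ (b ∷_))                             ≡⟨ *-distribˡ-sum r (λ b → ∑Vec n (F ∘ (b ∷_))) ⟩
      ∑[ b < r ] (r * ∑Vec n (F ∘ (b ∷_)))                           ≡⟨ sum-cong-≗ (λ b → ∑Vec-resample n x (F ∘ (b ∷_))) ⟩
      ∑[ b < r ] ∑Vec n (λ f → ∑[ a < r ] F (b ∷ (f [ x ]≔ a)))     ∎
      where open ≡-Reasoning

    -- Derandomisation coordinate by coordinate: for each first value take a tail that is at most
    -- average, then the first value for which the outcome is smallest.
    ∃-≤-average : ∀ n .{{_ : NonZero r}} (F : Vec (Fin r) n → ℕ) →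
                  Σ[ f ∈ Vec (Fin r) n ] r ^ n * F f ≤ ∑Vec n F
    ∃-≤-average zero    F = [] , ≤-reflexive (+-identityʳ (F []))
    ∃-≤-average (suc n) F = proj₁ a ∷ proj₁ (best (proj₁ a)) , (begin
      r * r ^ n * F (proj₁ a ∷ proj₁ (best (proj₁ a)))    ≡⟨ *-assoc r (r ^ n) _ ⟩
      r * (r ^ n * F (proj₁ a ∷ proj₁ (best (proj₁ a))))  ≤⟨ proj₂ a ⟩
      ∑[ b < r ] (r ^ n * F (b ∷ proj₁ (best b)))         ≤⟨ ∑-mono r (λ b → proj₂ (best b)) ⟩
      ∑Vec (suc n) F                                      ∎)
      where
      open ≤-Reasoning
      best : ∀ b → Σ[ f ∈ Vec (Fin r) n ] r ^ n * F (b ∷ f) ≤ ∑Vec n (F ∘ (b ∷_))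
      best b = ∃-≤-average n (F ∘ (b ∷_))
      a = ∃-minimum r (λ b → r ^ n * F (b ∷ proj₁ (best b)))
      ∑-mono : ∀ m {G H : Fin m → ℕ} → (∀ b → G b ≤ H b) → ∑[ b < m ] G b ≤ ∑[ b < m ] H b
      ∑-mono zero    G≤H = z≤n
      ∑-mono (suc m) G≤H = +-mono-≤ (G≤H zero) (∑-mono m (G≤H ∘ suc))

  Triple : ℕ → Set
  Triple n = Fin n × Fin n × Fin n

  Distinct : ∀ {n} → Triple n → Set
  Distinct (x , y , z) = x ≢ y × x ≢ z × y ≢ z

  colours : ∀ {n r} → Vec (Fin r) n → Triple n → Triple r
  colours f (x , y , z) = lookup f x , lookup f y , lookup f z

  module _ {r : ℕ} {Bad : Triple r → Set} (bad? : ∀ t → Dec (Bad t)) where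

    -- Divided by r^3, this is the probability that three distinct points receive bad colours.
    #bad : ℕ
    #bad = ∑[ a < r ] ∑[ b < r ] ∑[ c < r ] ind (bad? (a , b , c))

    -- Redrawing the three values in turn makes the colours of `t` uniform over all r^3 colour
    -- triples, at the price of a factor r each time.
    ∑Vec-triple : ∀ n (t : Triple n) → Distinct t →
                  r * (r * (r * ∑Vec n (λ f → ind (bad? (colours f t))))) ≡ r ^ n * #bad
    ∑Vec-triple n t@(x , y , z) (x≢y , x≢z , y≢z) = begin
      r * (r * (r * ∑Vec n F))
        ≡⟨ cong (λ s → r * (r * s)) (∑Vec-resample n x F) ⟩
      r * (r * ∑Vec n (λ f → ∑[ a < r ] F (f [ x ]≔ a)))
        ≡⟨ cong (r *_) (∑Vec-resample n y _) ⟩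
      r * ∑Vec n (λ f → ∑[ b < r ] ∑[ a < r ] F (f [ y ]≔ b [ x ]≔ a))
        ≡⟨ ∑Vec-resample n z _ ⟩
      ∑Vec n (λ f → ∑[ c < r ] ∑[ b < r ] ∑[ a < r ] F (f [ z ]≔ c [ y ]≔ b [ x ]≔ a))
        -- The three points are distinct, so no redrawn value overwrites another, and the summand no
        -- longer depends on `f`.
        ≡⟨ ∑Vec-cong n (λ f → sum-cong-≗ λ c → sum-cong-≗ λ b → sum-cong-≗ λ a →
             cong (λ t → ind (bad? t)) (colours-update f a b c)) ⟩
      ∑Vec n (λ f → ∑[ c < r ] ∑[ b < r ] ∑[ a < r ] G a b c)
        ≡⟨ ∑Vec-const n _ ⟩
      r ^ n * ∑[ c < r ] ∑[ b < r ] ∑[ a < r ] G a b c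
        ≡⟨ cong (r ^ n *_) reorder ⟩
      r ^ n * #bad ∎
      where
      open ≡-Reasoning
      F : Vec (Fin r) n → ℕ
      F f = ind (bad? (colours f t))
      G : Fin r → Fin r → Fin r → ℕ
      G a b c = ind (bad? (a , b , c))
      colours-update : ∀ f a b c → colours (f [ z ]≔ c [ y ]≔ b [ x ]≔ a) t ≡ (a , b , c)
      colours-update f a b c = cong₂ _,_
        (lookup∘update x (f [ z ]≔ c [ y ]≔ b) a)
        (cong₂ _,_
          (trans (lookup∘update′ (x≢y ∘ sym) (f [ z ]≔ c [ y ]≔ b) a) (lookup∘update y (f [ z ]≔ c) b))
          (trans (lookup∘update′ (x≢z ∘ sym) (f [ z ]≔ c [ y ]≔ b) a)
            (trans (lookup∘update′ (y≢z ∘ sym) (f [ z ]≔ c) b) (lookup∘update z f c))))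
      reorder : ∑[ c < r ] ∑[ b < r ] ∑[ a < r ] G a b c ≡ #bad
      reorder = begin
        ∑[ c < r ] ∑[ b < r ] ∑[ a < r ] G a b c  ≡⟨ sum-cong-≗ (λ c → ∑-comm {r} {r} (λ b a → G a b c)) ⟩
        ∑[ c < r ] ∑[ a < r ] ∑[ b < r ] G a b c  ≡⟨ ∑-comm {r} {r} (λ c a → ∑[ b < r ] G a b c) ⟩
        ∑[ a < r ] ∑[ c < r ] ∑[ b < r ] G a b c  ≡⟨ sum-cong-≗ (λ a → ∑-comm {r} {r} (λ c b → G a b c)) ⟩
        #bad                                      ∎

    -- Linearity of expectation: each triple of the list is bad with probability `#bad` / r^3, and
    -- some map does no worse than the average.
    ∃-few-bad : ∀ n .{{_ : NonZero r}} (ts : List (Triple n)) → All Distinct ts →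
                Σ[ f ∈ Vec (Fin r) n ]
                  r * (r * (r * length (filter (λ t → bad? (colours f t)) ts))) ≤ length ts * #bad
    ∃-few-bad n ts distinct = f , *-cancelˡ-≤ (r ^ n) (begin
        r ^ n * (r * (r * (r * Φ ts f)))   ≡⟨ shuffle (r ^ n) r (Φ ts f) ⟩
        r * (r * (r * (r ^ n * Φ ts f)))   ≤⟨ *-monoʳ-≤ r (*-monoʳ-≤ r (*-monoʳ-≤ r average)) ⟩
        r * (r * (r * ∑Vec n (Φ ts)))      ≡⟨ total ts distinct ⟩
        r ^ n * (length ts * #bad)         ∎)
      where
      open ≤-Reasoning
      Φ : List (Triple n) → Vec (Fin r) n → ℕ
      Φ ts f = length (filter (λ t → bad? (colours f t)) ts)
      f = proj₁ (∃-≤-average n (Φ ts))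
      average = proj₂ (∃-≤-average n (Φ ts))
      instance _ = m^n≢0 r n
      shuffle : ∀ p r s → p * (r * (r * (r * s))) ≡ r * (r * (r * (p * s)))
      shuffle = solve-∀
      distrib : ∀ r s t → r * (r * (r * (s + t))) ≡ r * (r * (r * s)) + r * (r * (r * t))
      distrib = solve-∀
      total : ∀ ts → All Distinct ts → r * (r * (r * ∑Vec n (Φ ts))) ≡ r ^ n * (length ts * #bad)
      total [] [] = trans
        (cong (λ s → r * (r * (r * s))) (trans (∑Vec-const n 0) (*-zeroʳ (r ^ n))))
        (zeros r (r ^ n))
        where
        zeros : ∀ r p → r * (r * (r * 0)) ≡ p * 0
        zeros = solve-∀
      total (t ∷ ts) (d ∷ ds) = begin-equality
        r * (r * (r * ∑Vec n (Φ (t ∷ ts))))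
          ≡⟨ cong (λ s → r * (r * (r * s)))
               (trans (∑Vec-cong n (λ f → length-filter-∷ (λ t → bad? (colours f t)) t ts)) (∑Vec-+ n _ (Φ ts))) ⟩
        r * (r * (r * (∑Vec n (λ f → ind (bad? (colours f t))) + ∑Vec n (Φ ts))))
          ≡⟨ distrib r _ _ ⟩
        r * (r * (r * ∑Vec n (λ f → ind (bad? (colours f t))))) + r * (r * (r * ∑Vec n (Φ ts)))
          ≡⟨ cong₂ _+_ (∑Vec-triple n t d) (total ts ds) ⟩
        r ^ n * #bad + r ^ n * (length ts * #bad)
          ≡⟨ *-distribˡ-+ (r ^ n) #bad _ ⟨
        r ^ n * (#bad + length ts * #bad) ∎

-- Stars, Berge copies of K₄, and decidable forms of the two Ramsey properties.

module Configurations where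

  open import Data.Bool.Base using (true; false)
  import Data.Bool.Properties as Bool
  open import Level using (0ℓ)
  open import Data.Fin.Base using (Fin; zero; suc)
  open import Data.Fin.Patterns using (0F; 1F; 2F; 3F; 4F; 5F)
  open import Data.Fin.Properties using (_≟_; any?; all?; suc-injective)
  open import Data.Fin.Subset
    using (Subset; inside; outside; ⊤; ⁅_⁆; _∪_; _∈_; _⊆_) renaming (∣_∣ to card)
  open import Data.Fin.Subset.Properties
    using (_∈?_; anySubset?; ∈⊤; x∈⁅x⁆; x∈⁅y⁆⇒x≡y; ∣⁅x⁆∣≡1; x∈p∪q⁺; x∈p∪q⁻; p⊂q⇒∣p∣<∣q∣; ⊆-antisym;
           ∪-identityˡ; ∪-identityʳ; ∪-comm)
  open import Data.List.Base using (List; []; _∷_)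
  import Data.List.Membership.Propositional as List
  open import Data.List.Membership.DecPropositional using () renaming (_∈?_ to listMember?)
  open import Data.List.Relation.Unary.All as ListAll using ([]; _∷_)
  open import Data.Vec.Base using (here; there)
  open import Data.Nat.Base using (ℕ; zero; suc; _≤_; z≤n; s≤s)
  import Data.Nat.Properties as ℕ
  open import Data.Product.Base using (Σ-syntax; ∃; ∃-syntax; _×_; _,_; proj₁; proj₂)
  open import Data.Product.Properties using (≡-dec)
  open import Data.Sum.Base using (_⊎_; inj₁; inj₂; [_,_]′)
  open import Data.Vec.Base using (Vec; []; _∷_; lookup; tabulate; map)
  import Data.Vec.Properties as Vec
  open import Data.Vec.Relation.Unary.All as All using (All; []; _∷_)
  import Data.Vec.Relation.Unary.All.Properties as AllP
  open import Data.Vec.Relation.Unary.AllPairs using (AllPairs; []; _∷_)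
  open import Data.Vec.Relation.Unary.Unique.Propositional.Properties using (lookup-injective)
  open import Function.Base using (_∘_; const)
  open import Relation.Binary.Core using (Rel)
  open import Relation.Binary.Definitions using (Symmetric)
  open import Relation.Binary.PropositionalEquality
    using (_≡_; _≢_; refl; sym; trans; cong; subst; subst₂; ≢-sym)
  open import Relation.Nullary.Decidable
    using (Dec; yes; no; map′; _×-dec_; _⊎-dec_; _→-dec_; ¬?; from-yes)
  open import Relation.Nullary.Negation using (contradiction)

  -- The Ramsey numbers are found constructively, by exhaustive search over finite types; this is
  -- the property of a type that such a search relies on.
  Searchable : Set → Set₁
  Searchable A = ∀ {P : A → Set} → (∀ x → Dec (P x)) → Dec (∃ P)

  searchVec : ∀ {A} → Searchable A → ∀ n → Searchable (Vec A n)
  searchVec search zero    P? = map′ ([] ,_) (λ { ([] , p) → p }) (P? [])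
  searchVec search (suc n) P? =
    map′ (λ { (x , xs , p) → x ∷ xs , p }) (λ { (x ∷ xs , p) → x , xs , p })
         (search λ x → searchVec search n λ xs → P? (x ∷ xs))

  Extensional : ∀ {A B : Set} → ((A → B) → Set) → Set
  Extensional Q = ∀ {g h} → (∀ x → g x ≡ h x) → Q g → Q h

  -- A colouring of the subsets of `suc n` points amounts to two colourings of the subsets of n
  -- points: one for the sets containing the first point, one for the others. The colouring
  -- reassembled by `join` agrees with the given one pointwise, whence the hypothesis
  -- `Extensional Q`.
  allSubsetFunctions? : ∀ n {k} {Q : (Subset n → Fin k) → Set} → Extensional Q →
                        (∀ g → Dec (Q g)) → Dec (∀ g → Q g)
  allSubsetFunctions? zero ext Q? =
    map′ (λ q g → ext (λ { [] → refl }) (q (g []))) (λ q a → q (const a)) (all? λ a → Q? (const a))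
  allSubsetFunctions? (suc n) {k} {Q} ext Q? =
    map′ (λ q g → ext (λ { (true ∷ s) → refl ; (false ∷ s) → refl }) (q (g ∘ (inside ∷_)) (g ∘ (outside ∷_))))
         (λ q g h → q (join g h))
         (allSubsetFunctions? n (λ g≗ q h → ext (λ { (true ∷ s) → g≗ s ; (false ∷ s) → refl }) (q h)) λ g →
          allSubsetFunctions? n (λ h≗ → ext λ { (true ∷ s) → refl ; (false ∷ s) → h≗ s }) λ h →
          Q? (join g h))
    where
    join : (Subset n → Fin k) → (Subset n → Fin k) → Subset (suc n) → Fin k
    join g h (true  ∷ s) = g s
    join g h (false ∷ s) = h s

  ∃-least : ∀ {P : ℕ → Set} → (∀ n → Dec (P n)) → ∀ {b} → P b → ∃[ n ] P n × (∀ m → P m → n ≤ m)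
  ∃-least P? {zero} Pb = zero , Pb , λ _ _ → z≤n
  ∃-least P? {suc b} Pb with P? zero
  ... | yes P0 = zero , P0 , λ _ _ → z≤n
  ... | no ¬P0 with n , Pn , least ← ∃-least (P? ∘ suc) Pb =
    suc n , Pn , λ { zero P0 → contradiction P0 ¬P0 ; (suc m) Pm → s≤s (least m Pm) }

  pair : ∀ {n} → Fin n → Fin n → Subset n
  pair x y = ⁅ x ⁆ ∪ ⁅ y ⁆

  module _ {n : ℕ} {x y : Fin n} where

    left∈pair : x ∈ pair x y
    left∈pair = x∈p∪q⁺ (inj₁ (x∈⁅x⁆ x))

    right∈pair : y ∈ pair x y
    right∈pair = x∈p∪q⁺ (inj₂ (x∈⁅x⁆ y))

    ∈pair⁻ : ∀ {z} → z ∈ pair x y → z ≡ x ⊎ z ≡ y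
    ∈pair⁻ z∈ = [ inj₁ ∘ x∈⁅y⁆⇒x≡y x , inj₂ ∘ x∈⁅y⁆⇒x≡y y ]′ (x∈p∪q⁻ ⁅ x ⁆ ⁅ y ⁆ z∈)

  card-pair : ∀ {n} {x y : Fin n} → x ≢ y → card (pair x y) ≡ 2
  card-pair {x = zero}  {zero}  x≢y = contradiction refl x≢y
  card-pair {x = zero}  {suc y} x≢y = cong suc (trans (cong card (∪-identityˡ ⁅ y ⁆)) (∣⁅x⁆∣≡1 y))
  card-pair {x = suc x} {zero}  x≢y = cong suc (trans (cong card (∪-identityʳ ⁅ x ⁆)) (∣⁅x⁆∣≡1 x))
  card-pair {x = suc x} {suc y} x≢y = card-pair (x≢y ∘ cong suc)

  -- Containment together with equal cardinality forces equality.
  card-2⇒pair : ∀ {n} {x y : Fin n} {s} → x ≢ y → x ∈ s → y ∈ s → card s ≡ 2 → s ≡ pair x y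
  card-2⇒pair {x = x} {y} {s} x≢y x∈s y∈s |s|≡2 = ⊆-antisym s⊆pair pair⊆s
    where
    pair⊆s : pair x y ⊆ s
    pair⊆s z∈ with ∈pair⁻ z∈
    ... | inj₁ refl = x∈s
    ... | inj₂ refl = y∈s
    s⊆pair : s ⊆ pair x y
    s⊆pair {z} z∈s with z ∈? pair x y
    ... | yes z∈ = z∈
    ... | no  z∉ = contradiction (p⊂q⇒∣p∣<∣q∣ (pair⊆s , z , z∈s , z∉))
                     (ℕ.<-irrefl (trans (card-pair x≢y) (sym |s|≡2)))

  -- Colourings of the r-sets are represented by colourings of all subsets.

  restrict : ∀ {r n k} → (Subset n → Fin k) → Coloring r n k
  restrict g (s , _) = g s

  extend : ∀ {r n k} → Coloring r n (suc k) → Subset n → Fin (suc k)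
  extend {r} c s with card s ℕ.≟ r
  ... | yes p = c (s , p)
  ... | no  _ = zero

  extend-≡ : ∀ {r n k} (c : Coloring r n (suc k)) s p → extend c s ≡ c (s , p)
  extend-≡ {r} c s p with card s ℕ.≟ r
  ... | yes p′ = cong (λ p → c (s , p)) (ℕ.≡-irrelevant p′ p)
  ... | no  ¬p = contradiction p ¬p

  HasColour : ∀ r {n k} → (Subset n → Fin k) → Fin k → Subset n → Set
  HasColour r g i s = card s ≡ r × g s ≡ i

  -- A triangle q of colour i, with a further edge of colour i at each of its
  -- vertices. Which member of K₄⋆ arises is determined by the coincidences
  -- among the other ends r of these edges.
  IsStar : ∀ {n k} → (Fin n → Fin n → Fin k) → Fin k → (q r : Fin 3 → Fin n) → Set
  IsStar χ i q r =
    (∀ x y → x ≢ y → q x ≢ q y) × (∀ x y → r x ≢ q y) ×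
    (∀ x y → x ≢ y → χ (q x) (q y) ≡ i) × (∀ x → χ (q x) (r x) ≡ i)

  -- The vertices are stored in vectors, which `searchVec` can enumerate.
  HasStar : ∀ {n k} → (Fin n → Fin n → Fin k) → Set
  HasStar {n} {k} χ = Σ[ i ∈ Fin k ] Σ[ q ∈ Vec (Fin n) 3 ] Σ[ r ∈ Vec (Fin n) 3 ]
    IsStar χ i (lookup q) (lookup r)

  onPairs : ∀ {n k} → (Subset n → Fin k) → Fin n → Fin n → Fin k
  onPairs g x y = g (pair x y)

  isStar? : ∀ {n k} (χ : Fin n → Fin n → Fin k) i q r → Dec (IsStar χ i q r)
  isStar? χ i q r =
    (all? λ x → all? λ y → ¬? (x ≟ y) →-dec ¬? (q x ≟ q y)) ×-dec
    (all? λ x → all? λ y → ¬? (r x ≟ q y)) ×-dec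
    (all? λ x → all? λ y → ¬? (x ≟ y) →-dec χ (q x) (q y) ≟ i) ×-dec
    (all? λ x → χ (q x) (r x) ≟ i)

  hasStar? : ∀ {n k} (χ : Fin n → Fin n → Fin k) → Dec (HasStar χ)
  hasStar? χ = any? λ i → searchVec any? 3 λ q → searchVec any? 3 λ r → isStar? χ i (lookup q) (lookup r)

  hasStar-ext : ∀ {n k} {χ χ′ : Fin n → Fin n → Fin k} → (∀ x y → χ x y ≡ χ′ x y) → HasStar χ → HasStar χ′
  hasStar-ext χ≗ (i , q , r , q≢ , r≢q , qq , qr) =
    i , q , r , q≢ , r≢q , (λ x y x≢y → trans (sym (χ≗ _ _)) (qq x y x≢y)) , (λ x → trans (sym (χ≗ _ _)) (qr x))

  -- `AllPairs` records each pair of positions in increasing order only; symmetry supplies the other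
  -- order.
  lookupPair : ∀ {A : Set} {R : Rel A 0ℓ} {n} {xs : Vec A n} → Symmetric R → AllPairs R xs →
               ∀ {x y} → x ≢ y → R (lookup xs x) (lookup xs y)
  lookupPair symR (px ∷ pxs) {zero}  {zero}  x≢y = contradiction refl x≢y
  lookupPair symR (px ∷ pxs) {zero}  {suc y} x≢y = AllP.lookup⁺ px y
  lookupPair symR (px ∷ pxs) {suc x} {zero}  x≢y = symR (AllP.lookup⁺ px x)
  lookupPair symR (px ∷ pxs) {suc x} {suc y} x≢y = lookupPair symR pxs (x≢y ∘ cong suc)

  module _ {n k : ℕ} (c : Coloring 2 n (suc k)) where

    private
      χ : Fin n → Fin n → Fin (suc k)
      χ = onPairs (extend c)

    Joined : Fin (suc k) → Rel (Fin n) _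
    Joined i u v = Σ[ e ∈ Edge 2 n ] u ∈ proj₁ e × v ∈ proj₁ e × c e ≡ i

    joined-sym : ∀ {i} → Symmetric (Joined i)
    joined-sym (e , u∈ , v∈ , ce) = e , v∈ , u∈ , ce

    joined : ∀ {i u v} → u ≢ v → χ u v ≡ i → Joined i u v
    joined u≢v χ≡i =
      (_ , card-pair u≢v) , left∈pair , right∈pair , trans (sym (extend-≡ c _ (card-pair u≢v))) χ≡i

    -- One, two or three distinct values among the ends `r 0F`, `r 1F`, `r 2F` give `K₄`,
    -- `K₄⁻+pendant` or `triangle+pendants` respectively.
    star⇒mono : HasStar χ → MonoGraph K₄⋆ c
    star⇒mono (i , qs , rs , q≢ , r≢q , qq , qr) = byCoincidences (r 0F ≟ r 1F) (r 0F ≟ r 2F) (r 1F ≟ r 2F)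
      where
      q = lookup qs
      r = lookup rs

      q—q : ∀ x y → x ≢ y → Joined i (q x) (q y)
      q—q x y x≢y = joined (q≢ x y x≢y) (qq x y x≢y)

      q—r : ∀ x → Joined i (q x) (r x)
      q—r x = joined (≢-sym (r≢q x x)) (qr x)

      q≢r : ∀ x y → q x ≢ r y
      q≢r x y = ≢-sym (r≢q y x)

      fromEdgesMono : ∀ {m} es (φs : Vec (Fin n) m) → K₄⋆ (fromEdges m es) → AllPairs _≢_ φs →
                      ListAll.All (λ (x , y) → Joined i (lookup φs x) (lookup φs y)) es → MonoGraph K₄⋆ c
      fromEdgesMono es φs G∈ unique edges =
        i , fromEdges _ es , G∈ , lookup φs , lookup-injective unique _ _ ,
        λ { (_ , inj₁ e) → ListAll.lookup edges e ; (_ , inj₂ e) → joined-sym (ListAll.lookup edges e) }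

      allEqual : r 1F ≡ r 0F → r 2F ≡ r 0F → MonoGraph K₄⋆ c
      allEqual r₁≡r₀ r₂≡r₀ =
        i , K₄ , inj₁ refl , lookup φs , lookup-injective unique _ _ , lookupPair joined-sym edges
        where
        φs = q 0F ∷ q 1F ∷ q 2F ∷ r 0F ∷ []
        unique : AllPairs _≢_ φs
        unique = (q≢ _ _ (λ ()) ∷ q≢ _ _ (λ ()) ∷ q≢r _ _ ∷ [])
               ∷ (q≢ _ _ (λ ()) ∷ q≢r _ _ ∷ [])
               ∷ (q≢r _ _ ∷ [])
               ∷ [] ∷ []
        edges : AllPairs (Joined i) φs
        edges = (q—q _ _ (λ ()) ∷ q—q _ _ (λ ()) ∷ q—r 0F ∷ [])
              ∷ (q—q _ _ (λ ()) ∷ subst (Joined i (q 1F)) r₁≡r₀ (q—r 1F) ∷ [])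
              ∷ (subst (Joined i (q 2F)) r₂≡r₀ (q—r 2F) ∷ [])
              ∷ [] ∷ []

      twoEqual : ∀ x y z → x ≢ y → x ≢ z → y ≢ z → r y ≡ r x → r x ≢ r z → MonoGraph K₄⋆ c
      twoEqual x y z x≢y x≢z y≢z ry≡rx rx≢rz = fromEdgesMono _ φs (inj₂ (inj₁ refl)) unique edges
        where
        -- In the numbering of `K₄⁻+pendant`: `q z` carries the pendant edge to `r z`, and the
        -- missing edge of K₄ is the one between `q z` and the shared end `r x`.
        φs = q z ∷ r x ∷ q x ∷ q y ∷ r z ∷ []
        unique : AllPairs _≢_ φs
        unique = (q≢r _ _ ∷ q≢ _ _ (≢-sym x≢z) ∷ q≢ _ _ (≢-sym y≢z) ∷ q≢r _ _ ∷ [])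
               ∷ (r≢q _ _ ∷ r≢q _ _ ∷ rx≢rz ∷ [])
               ∷ (q≢ _ _ x≢y ∷ q≢r _ _ ∷ [])
               ∷ (q≢r _ _ ∷ [])
               ∷ [] ∷ []
        edges = q—q z x (≢-sym x≢z) ∷ q—q z y (≢-sym y≢z) ∷ joined-sym (q—r x)
              ∷ joined-sym (subst (Joined i (q y)) ry≡rx (q—r y)) ∷ q—q x y x≢y ∷ q—r z ∷ []

      allDistinct : r 0F ≢ r 1F → r 0F ≢ r 2F → r 1F ≢ r 2F → MonoGraph K₄⋆ c
      allDistinct r₀≢r₁ r₀≢r₂ r₁≢r₂ = fromEdgesMono _ φs (inj₂ (inj₂ refl)) unique edges
        where
        φs = q 0F ∷ q 1F ∷ q 2F ∷ r 0F ∷ r 1F ∷ r 2F ∷ []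
        unique : AllPairs _≢_ φs
        unique = (q≢ _ _ (λ ()) ∷ q≢ _ _ (λ ()) ∷ q≢r _ _ ∷ q≢r _ _ ∷ q≢r _ _ ∷ [])
               ∷ (q≢ _ _ (λ ()) ∷ q≢r _ _ ∷ q≢r _ _ ∷ q≢r _ _ ∷ [])
               ∷ (q≢r _ _ ∷ q≢r _ _ ∷ q≢r _ _ ∷ [])
               ∷ (r₀≢r₁ ∷ r₀≢r₂ ∷ [])
               ∷ (r₁≢r₂ ∷ [])
               ∷ [] ∷ []
        edges = q—q 0F 1F (λ ()) ∷ q—q 0F 2F (λ ()) ∷ q—q 1F 2F (λ ()) ∷ q—r 0F ∷ q—r 1F ∷ q—r 2F ∷ []

      byCoincidences : Dec (r 0F ≡ r 1F) → Dec (r 0F ≡ r 2F) → Dec (r 1F ≡ r 2F) → MonoGraph K₄⋆ c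
      byCoincidences (yes e) (yes e′) _      = allEqual (sym e) (sym e′)
      byCoincidences (yes e) (no ne) _       = twoEqual 0F 1F 2F (λ ()) (λ ()) (λ ()) (sym e) ne
      byCoincidences (no ne) (yes e) _       = twoEqual 0F 2F 1F (λ ()) (λ ()) (λ ()) (sym e) ne
      byCoincidences (no ne) (no _)  (yes e) = twoEqual 1F 2F 0F (λ ()) (λ ()) (λ ()) (sym e) (≢-sym ne)
      byCoincidences (no r₀≢r₁) (no r₀≢r₂) (no r₁≢r₂) = allDistinct r₀≢r₁ r₀≢r₂ r₁≢r₂

  IsStarIn : (G : Graph) → (t s : Vec (Fin (Graph.order G)) 3) → Set
  IsStarIn G t s =
    (∀ x y → x ≢ y → lookup t x ≢ lookup t y) × (∀ x y → lookup s x ≢ lookup t y) ×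
    (∀ x y → x ≢ y → Adj (lookup t x) (lookup t y)) × (∀ x → Adj (lookup t x) (lookup s x))
    where open Graph G

  isStarIn? : ∀ G → (∀ x y → Dec (Graph.Adj G x y)) → ∀ t s → Dec (IsStarIn G t s)
  isStarIn? G adj? t s =
    (all? λ x → all? λ y → ¬? (x ≟ y) →-dec ¬? (lookup t x ≟ lookup t y)) ×-dec
    (all? λ x → all? λ y → ¬? (lookup s x ≟ lookup t y)) ×-dec
    (all? λ x → all? λ y → ¬? (x ≟ y) →-dec adj? (lookup t x) (lookup t y)) ×-dec
    (all? λ x → adj? (lookup t x) (lookup s x))

  fromEdgesAdj? : ∀ n es x y → Dec (Graph.Adj (fromEdges n es) x y)
  fromEdgesAdj? n es x y = ¬? (x ≟ y) ×-dec ((x , y) ∈es? ⊎-dec (y , x) ∈es?)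
    where
    _∈es? : ∀ e → Dec (e List.∈ es)
    e ∈es? = listMember? (≡-dec _≟_ _≟_) e es

  -- Each of the three graphs has a triangle `t` whose vertices have neighbours `s` outside it. The
  -- conditions are checked by computation.
  K₄⋆-star : ∀ G → K₄⋆ G → Σ[ t ∈ Vec (Fin (Graph.order G)) 3 ] Σ[ s ∈ Vec (Fin (Graph.order G)) 3 ] IsStarIn G t s
  K₄⋆-star _ (inj₁ refl) = t , s , from-yes (isStarIn? K₄ (λ x y → ¬? (x ≟ y)) t s)
    where
    t = 0F ∷ 1F ∷ 2F ∷ []
    s = 3F ∷ 3F ∷ 3F ∷ []
  K₄⋆-star _ (inj₂ (inj₁ refl)) = t , s , from-yes (isStarIn? K₄⁻+pendant (fromEdgesAdj? _ _) t s)
    where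
    -- The other triangle, on 1, 2, 3, would not do: vertex 1 has degree 2.
    t = 0F ∷ 2F ∷ 3F ∷ []
    s = 4F ∷ 1F ∷ 1F ∷ []
  K₄⋆-star _ (inj₂ (inj₂ refl)) = t , s , from-yes (isStarIn? triangle+pendants (fromEdgesAdj? _ _) t s)
    where
    t = 0F ∷ 1F ∷ 2F ∷ []
    s = 3F ∷ 4F ∷ 5F ∷ []

  mono⇒star : ∀ {n k} (g : Subset n → Fin k) → MonoGraph K₄⋆ (restrict g) → HasStar (onPairs g)
  mono⇒star g (i , G , G∈ , φ , φ-inj , φ-edge) with t , s , t≢ , s≢t , tt , ts ← K₄⋆-star G G∈ =
    i , map φ t , map φ s ,
    (λ x y x≢y → subst₂ _≢_ (φt x) (φt y) (t≢ x y x≢y ∘ φ-inj)) ,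
    (λ x y → subst₂ _≢_ (φs x) (φt y) (s≢t x y ∘ φ-inj)) ,
    (λ x y x≢y → subst₂ (λ u v → g (pair u v) ≡ i) (φt x) (φt y) (coloured (t≢ x y x≢y) (tt x y x≢y))) ,
    (λ x → subst₂ (λ u v → g (pair u v) ≡ i) (φt x) (φs x) (coloured (≢-sym (s≢t x x)) (ts x)))
    where
    open Graph G
    φt = λ x → sym (Vec.lookup-map x φ t)
    φs = λ x → sym (Vec.lookup-map x φ s)
    coloured : ∀ {x y} → x ≢ y → Adj x y → g (pair (φ x) (φ y)) ≡ i
    coloured x≢y xy with (e , |e|≡2) , x∈e , y∈e , ge≡i ← φ-edge xy =
      trans (cong g (sym (card-2⇒pair (x≢y ∘ φ-inj) x∈e y∈e |e|≡2))) ge≡i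

  -- Berge copies of K₄ and the link of a vertex.

  IsBergeK₄ : ∀ {n k} → (Subset n → Fin k) → Fin k → (Fin 4 → Fin n) → (Fin 4 → Fin 4 → Subset n) → Set
  IsBergeK₄ g i φ edge =
    (∀ x y → φ x ≡ φ y → x ≡ y) ×
    (∀ x y → edge x y ≡ edge y x) ×
    (∀ x y → x ≢ y → HasColour 3 g i (edge x y)) ×
    (∀ x y → x ≢ y → φ x ∈ edge x y × φ y ∈ edge x y) ×
    (∀ x y z w → x ≢ y → z ≢ w → edge x y ≡ edge z w → (x ≡ z × y ≡ w) ⊎ (x ≡ w × y ≡ z))

  -- No hypergraph is mentioned: all triples of colour `i` may serve as one, and the remaining data
  -- form a finite table that can be searched.
  HasBergeK₄ : ∀ {n k} → (Subset n → Fin k) → Set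
  HasBergeK₄ {n} {k} g = Σ[ i ∈ Fin k ] Σ[ φ ∈ Vec (Fin n) 4 ] Σ[ es ∈ Vec (Vec (Subset n) 4) 4 ]
    IsBergeK₄ g i (lookup φ) (λ x → lookup (lookup es x))

  isBergeK₄? : ∀ {n k} (g : Subset n → Fin k) i φ edge → Dec (IsBergeK₄ g i φ edge)
  isBergeK₄? g i φ edge =
    (all? λ x → all? λ y → φ x ≟ φ y →-dec x ≟ y) ×-dec
    (all? λ x → all? λ y → edge x y ≟ₛ edge y x) ×-dec
    (all? λ x → all? λ y → ¬? (x ≟ y) →-dec (card (edge x y) ℕ.≟ 3 ×-dec g (edge x y) ≟ i)) ×-dec
    (all? λ x → all? λ y → ¬? (x ≟ y) →-dec (φ x ∈? edge x y ×-dec φ y ∈? edge x y)) ×-dec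
    (all? λ x → all? λ y → all? λ z → all? λ w → ¬? (x ≟ y) →-dec ¬? (z ≟ w) →-dec edge x y ≟ₛ edge z w →-dec
      ((x ≟ z ×-dec y ≟ w) ⊎-dec (x ≟ w ×-dec y ≟ z)))
    where
    _≟ₛ_ : ∀ {n} (s t : Subset n) → Dec (s ≡ t)
    _≟ₛ_ = Vec.≡-dec Bool._≟_

  hasBergeK₄? : ∀ {n k} (g : Subset n → Fin k) → Dec (HasBergeK₄ g)
  hasBergeK₄? g = any? λ i → searchVec any? 4 λ φ → searchVec (searchVec anySubset? 4) 4 λ es →
    isBergeK₄? g i (lookup φ) (λ x → lookup (lookup es x))

  hasBergeK₄-ext : ∀ {n k} → Extensional (HasBergeK₄ {n} {k})
  hasBergeK₄-ext g≗h (i , φ , es , inj , symE , col , inc , dist) =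
    i , φ , es , inj , symE ,
    (λ x y x≢y → proj₁ (col x y x≢y) , trans (sym (g≗h _)) (proj₂ (col x y x≢y))) , inc , dist

  BergeK₄⇒mono : ∀ {n k} (c : Coloring 3 n (suc k)) → HasBergeK₄ (extend c) → MonoHypergraph (Berge K₄) c
  BergeK₄⇒mono {n} c (i , φ , es , inj , symE , col , inc , dist) = i , H , berge , λ s e → e
    where
    H : Hypergraph n
    H = record { V = ⊤ ; E = λ s → Σ[ p ∈ card s ≡ 3 ] c (s , p) ≡ i ; E⊆V = λ _ _ → ∈⊤ }
    berge : Berge K₄ H
    berge = record
      { φ = lookup φ ; φ∈V = λ _ → ∈⊤ ; φ-injective = inj _ _
      ; edge = λ x → lookup (lookup es x) ; edge-sym = symE
      ; edge∈E = λ {x} {y} x≢y → let p , gi = col x y x≢y in p , trans (sym (extend-≡ c _ p)) gi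
      ; φ∈edge = inc _ _ ; edge-distinct = dist _ _ _ _ }

  bergeK₄ : ∀ {n k} (g : Subset n → Fin k) {i φ edge} → IsBergeK₄ g i φ edge → HasBergeK₄ g
  bergeK₄ g {i} {φ} {edge} (inj , symE , col , inc , dist) = i , tabulate φ , tabulate (tabulate ∘ edge) ,
    (λ x y eq → inj x y (trans (sym (lφ x)) (trans eq (lφ y)))) ,
    (λ x y → trans (le x y) (trans (symE x y) (sym (le y x)))) ,
    (λ x y x≢y → subst (HasColour 3 g i) (sym (le x y)) (col x y x≢y)) ,
    (λ x y x≢y → subst₂ _∈_ (sym (lφ x)) (sym (le x y)) (proj₁ (inc x y x≢y)) ,
                 subst₂ _∈_ (sym (lφ y)) (sym (le x y)) (proj₂ (inc x y x≢y))) ,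
    (λ x y z w x≢y z≢w eq → dist x y z w x≢y z≢w (trans (sym (le x y)) (trans eq (le z w))))
    where
    lφ = Vec.lookup∘tabulate φ
    le : ∀ x y → lookup (lookup (tabulate (tabulate ∘ edge)) x) y ≡ edge x y
    le x y = trans (cong (λ v → lookup v y) (Vec.lookup∘tabulate (tabulate ∘ edge) x)) (Vec.lookup∘tabulate (edge x) y)

  mono⇒BergeK₄ : ∀ {n k} (g : Subset n → Fin k) → MonoHypergraph (Berge K₄) (restrict g) → HasBergeK₄ g
  mono⇒BergeK₄ g (i , H , b , mono) = bergeK₄ g
    ((λ _ _ → φ-injective) , edge-sym , (λ _ _ x≢y → mono _ (edge∈E x≢y)) , (λ _ _ → φ∈edge) , (λ _ _ _ _ → edge-distinct))
    where open Berge b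

  -- Sets `inside ∷ s` are those containing `zero`, so the star lives in the link of `zero`. Up to
  -- the shift by `suc`, the core pair `zero`, `q x` gets the hyperedge with elements `zero`, `q x`,
  -- `r x`, and the core pair `q x`, `q y` the one with elements `zero`, `q x`, `q y`.
  star⇒BergeK₄ : ∀ {m k} (g : Subset (suc m) → Fin k) → HasStar (onPairs (g ∘ (inside ∷_))) → HasBergeK₄ g
  star⇒BergeK₄ {m} {k} g (i , qs , rs , q≢ , r≢q , qq , qr) =
    bergeK₄ g (φ-injective , edge-sym , edge-colour , φ∈edge , edge-distinct)
    where
    q = lookup qs
    r = lookup rs

    q-injective : ∀ {x y} → q x ≡ q y → x ≡ y
    q-injective {x} {y} qx≡qy with x ≟ y
    ... | yes x≡y = x≡y
    ... | no  x≢y = contradiction qx≡qy (q≢ x y x≢y)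

    φ : Fin 4 → Fin (suc m)
    φ zero    = zero
    φ (suc x) = suc (q x)

    edge : Fin 4 → Fin 4 → Subset (suc m)
    -- A filler: the diagonal of the table carries no hyperedge.
    edge zero    zero    = ⊤
    edge zero    (suc y) = inside ∷ pair (q y) (r y)
    edge (suc x) zero    = inside ∷ pair (q x) (r x)
    edge (suc x) (suc y) = inside ∷ pair (q x) (q y)

    φ-injective : ∀ x y → φ x ≡ φ y → x ≡ y
    φ-injective zero    zero    _  = refl
    φ-injective (suc x) (suc y) eq = cong suc (q-injective (suc-injective eq))

    edge-sym : ∀ x y → edge x y ≡ edge y x
    edge-sym zero    zero    = refl
    edge-sym zero    (suc y) = refl
    edge-sym (suc x) zero    = refl
    edge-sym (suc x) (suc y) = cong (inside ∷_) (∪-comm ⁅ q x ⁆ ⁅ q y ⁆)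

    spoke-colour : ∀ x → HasColour 3 g i (inside ∷ pair (q x) (r x))
    spoke-colour x = cong suc (card-pair (≢-sym (r≢q x x))) , qr x

    edge-colour : ∀ x y → x ≢ y → HasColour 3 g i (edge x y)
    edge-colour zero    zero    x≢y = contradiction refl x≢y
    edge-colour zero    (suc y) _   = spoke-colour y
    edge-colour (suc x) zero    _   = spoke-colour x
    edge-colour (suc x) (suc y) x≢y = cong suc (card-pair (q≢ x y (x≢y ∘ cong suc))) , qq x y (x≢y ∘ cong suc)

    φ∈edge : ∀ x y → x ≢ y → φ x ∈ edge x y × φ y ∈ edge x y
    φ∈edge zero    zero    x≢y = contradiction refl x≢y
    φ∈edge zero    (suc y) _   = here , there left∈pair
    φ∈edge (suc x) zero    _   = there left∈pair , here
    φ∈edge (suc x) (suc y) _   = there left∈pair , there right∈pair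

    -- `q x` lies on the spoke of `y`, and the outer end `r y` of that spoke avoids the triangle.
    spokes : ∀ x y → inside ∷ pair (q x) (r x) ≡ inside ∷ pair (q y) (r y) → x ≡ y
    spokes x y eq with ∈pair⁻ (subst (q x ∈_) (Vec.∷-injectiveʳ eq) left∈pair)
    ... | inj₁ qx≡qy = q-injective qx≡qy
    ... | inj₂ qx≡ry = contradiction (sym qx≡ry) (r≢q y x)

    -- The end `r x` lies on the spoke, whereas a rim contains, besides `zero`, only vertices of the
    -- triangle.
    spoke≢rim : ∀ x y z → inside ∷ pair (q x) (r x) ≢ inside ∷ pair (q y) (q z)
    spoke≢rim x y z eq = [ r≢q x y , r≢q x z ]′ (∈pair⁻ (subst (r x ∈_) (Vec.∷-injectiveʳ eq) right∈pair))

    rims : ∀ x y z w → x ≢ y → inside ∷ pair (q x) (q y) ≡ inside ∷ pair (q z) (q w) →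
           (x ≡ z × y ≡ w) ⊎ (x ≡ w × y ≡ z)
    rims x y z w x≢y eq
      with ∈pair⁻ (subst (q x ∈_) (Vec.∷-injectiveʳ eq) left∈pair)
         | ∈pair⁻ (subst (q y ∈_) (Vec.∷-injectiveʳ eq) right∈pair)
    ... | inj₁ xz | inj₁ yz = contradiction (q-injective (trans xz (sym yz))) x≢y
    ... | inj₁ xz | inj₂ yw = inj₁ (q-injective xz , q-injective yw)
    ... | inj₂ xw | inj₁ yz = inj₂ (q-injective xw , q-injective yz)
    ... | inj₂ xw | inj₂ yw = contradiction (q-injective (trans xw (sym yw))) x≢y

    edge-distinct : ∀ x y z w → x ≢ y → z ≢ w → edge x y ≡ edge z w → (x ≡ z × y ≡ w) ⊎ (x ≡ w × y ≡ z)
    edge-distinct zero    zero    _       _       x≢y _   _  = contradiction refl x≢y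
    edge-distinct _       _       zero    zero    _   z≢w _  = contradiction refl z≢w
    edge-distinct zero    (suc y) zero    (suc w) _   _   eq = inj₁ (refl , cong suc (spokes y w eq))
    edge-distinct zero    (suc y) (suc z) zero    _   _   eq = inj₂ (refl , cong suc (spokes y z eq))
    edge-distinct (suc x) zero    zero    (suc w) _   _   eq = inj₂ (cong suc (spokes x w eq) , refl)
    edge-distinct (suc x) zero    (suc z) zero    _   _   eq = inj₁ (cong suc (spokes x z eq) , refl)
    edge-distinct zero    (suc y) (suc z) (suc w) _   _   eq = contradiction eq (spoke≢rim y z w)
    edge-distinct (suc x) zero    (suc z) (suc w) _   _   eq = contradiction eq (spoke≢rim x z w)
    edge-distinct (suc x) (suc y) zero    (suc w) _   _   eq = contradiction (sym eq) (spoke≢rim w x y)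
    edge-distinct (suc x) (suc y) (suc z) zero    _   _   eq = contradiction (sym eq) (spoke≢rim z x y)
    edge-distinct (suc x) (suc y) (suc z) (suc w) x≢y _   eq
      with rims x y z w (x≢y ∘ cong suc) eq
    ... | inj₁ (refl , refl) = inj₁ (refl , refl)
    ... | inj₂ (refl , refl) = inj₂ (refl , refl)

  RamseyGraph RamseyBerge : ℕ → ℕ → Set
  RamseyGraph k n = (g : Subset n → Fin k) → HasStar (onPairs g)
  RamseyBerge k n = (g : Subset n → Fin k) → HasBergeK₄ g

  ramseyGraph? : ∀ k n → Dec (RamseyGraph k n)
  ramseyGraph? k n = allSubsetFunctions? n (λ g≗ → hasStar-ext (λ x y → g≗ (pair x y))) (hasStar? ∘ onPairs)

  ramseyBerge? : ∀ k n → Dec (RamseyBerge k n)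
  ramseyBerge? k n = allSubsetFunctions? n hasBergeK₄-ext hasBergeK₄?

  ramseyGraph⇒ramseyBerge : ∀ {k n} → RamseyGraph k n → RamseyBerge k (suc n)
  ramseyGraph⇒ramseyBerge star g = star⇒BergeK₄ g (star (g ∘ (inside ∷_)))

  -- Extending colourings carries over the Ramsey property of n; restricting them carries over its
  -- minimality.
  leastRamseyGraph⇒IsR : ∀ {k n} → IsLeast (RamseyGraph (suc k)) n → IsR K₄⋆ (suc k) n
  leastRamseyGraph⇒IsR (ramsey , least) =
    (λ c → star⇒mono c (ramsey (extend c))) , λ m mono → least m λ g → mono⇒star g (mono (restrict g))

  leastRamseyBerge⇒IsR₃ : ∀ {k n} → IsLeast (RamseyBerge (suc k)) n → IsR₃ (Berge K₄) (suc k) n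
  leastRamseyBerge⇒IsR₃ (ramsey , least) =
    (λ c → BergeK₄⇒mono c (ramsey (extend c))) , λ m mono → least m λ g → mono⇒BergeK₄ g (mono (restrict g))

-- Lower bound: families of maps to three parts that separate all triples.

module LowerBound where

  open Averaging
  open Configurations
  open import Data.Fin.Base using (Fin; zero; suc)
  open import Data.Fin.Properties using (_≟_; any?; all?; pigeonhole; <⇒≢)
  open import Data.Fin.Subset using (Subset; inside; outside; _∈_; _∉_; _⊆_) renaming (∣_∣ to card)
  open import Data.Fin.Subset.Properties using (_∈?_; drop-there; s⊆s)
  open import Data.List.Base using (List; []; _∷_; length; filter; allFin; cartesianProduct)
  import Data.List.Membership.Propositional as List
  open import Data.List.Membership.Propositional.Properties
    using (∈-filter⁺; ∈-cartesianProduct⁺; ∈-allFin)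
  open import Data.List.Properties using (length-filter; length-tabulate)
  open import Data.List.Relation.Unary.All using (All)
  open import Data.List.Relation.Unary.All.Properties using (all-filter; filter⁺)
  open import Data.Nat.Base using (zero; suc; _*_; _^_; _≤_; _<_)
  open import Data.Nat.Properties hiding (_≟_; <⇒≢)
  open import Data.Nat.Tactic.RingSolver using (solve-∀)
  open import Data.Product.Base using (Σ-syntax; ∃-syntax; _×_; _,_; proj₁; proj₂; map₂)
  open import Data.Sum.Base using (_⊎_; inj₁; inj₂; [_,_]′; map₁)
  open import Data.Vec.Base using (Vec; []; _∷_; lookup; here; there)
  open import Function.Base using (_∘_; id)
  open import Relation.Binary.PropositionalEquality
    using (_≡_; _≢_; refl; sym; trans; cong; cong₂; subst; subst₂)
  open import Relation.Nullary.Decidable using (Dec; yes; no; _×-dec_; _→-dec_; ¬?)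
  open import Relation.Nullary.Negation using (¬_; contradiction)

  distinct? : ∀ {n} (t : Triple n) → Dec (Distinct t)
  distinct? (x , y , z) = ¬? (x ≟ y) ×-dec ¬? (x ≟ z) ×-dec ¬? (y ≟ z)

  -- Of the 27 colourings of three points, 6 are injective.
  #nonInjective : #bad {3} (λ t → ¬? (distinct? t)) ≡ 21
  #nonInjective = refl

  unseparated : ∀ {n r} → Vec (Fin r) n → List (Triple n) → List (Triple n)
  unseparated f = filter (λ t → ¬? (distinct? (colours f t)))

  -- A random map fails to separate a triple with probability 21/27; cancelling a factor 3 leaves
  -- 7/9.
  ∃-separating : ∀ n (ts : List (Triple n)) → All Distinct ts →
                 Σ[ f ∈ Vec (Fin 3) n ] 9 * length (unseparated f ts) ≤ 7 * length ts
  ∃-separating n ts distinct = map₂ (λ {f} le →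
      rescale (length (unseparated f ts)) (length ts)
        (subst (λ b → 3 * (3 * (3 * length (unseparated f ts))) ≤ length ts * b) #nonInjective le))
    (∃-few-bad (λ t → ¬? (distinct? t)) n ts distinct)
    where
    left : ∀ l → 3 * (3 * (3 * l)) ≡ 3 * (9 * l)
    left = solve-∀
    right : ∀ l → l * 21 ≡ 3 * (7 * l)
    right = solve-∀
    rescale : ∀ l m → 3 * (3 * (3 * l)) ≤ m * 21 → 9 * l ≤ 7 * m
    rescale l m le = *-cancelˡ-≤ 3 (subst₂ _≤_ (left l) (right m) le)

  -- Each new map is chosen for the triples that the earlier ones leave unseparated, so every step
  -- multiplies their number by at most 7/9.
  separatingFamily : ∀ K n (ts : List (Triple n)) → All Distinct ts →
    Σ[ fs ∈ Vec (Vec (Fin 3) n) K ] Σ[ rest ∈ List (Triple n) ]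
      9 ^ K * length rest ≤ 7 ^ K * length ts ×
      (∀ {t} → t List.∈ ts → (∃[ i ] Distinct (colours (lookup fs i) t)) ⊎ t List.∈ rest)
  separatingFamily zero    n ts distinct = [] , ts , ≤-refl , inj₂
  separatingFamily (suc K) n ts distinct =
    let f , le = ∃-separating n ts distinct
        fs , rest , le′ , cover = separatingFamily K n (unseparated f ts) (filter⁺ _ distinct)
    in f ∷ fs , rest , bound (9 ^ K) (7 ^ K) _ _ _ le′ le , cover′ f fs cover
    where
    open ≤-Reasoning
    swap : ∀ a b c → a * (b * c) ≡ b * (a * c)
    swap = solve-∀
    bound : ∀ p q l m o → p * l ≤ q * m → 9 * m ≤ 7 * o → 9 * p * l ≤ 7 * q * o
    bound p q l m o pl≤qm 9m≤7o = begin
      9 * p * l    ≡⟨ *-assoc 9 p l ⟩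
      9 * (p * l)  ≤⟨ *-monoʳ-≤ 9 pl≤qm ⟩
      9 * (q * m)  ≡⟨ swap 9 q m ⟩
      q * (9 * m)  ≤⟨ *-monoʳ-≤ q 9m≤7o ⟩
      q * (7 * o)  ≡⟨ swap q 7 o ⟩
      7 * (q * o)  ≡⟨ *-assoc 7 q o ⟨
      7 * q * o    ∎
    cover′ : ∀ f (fs : Vec _ K) {rest} →
             (∀ {t} → t List.∈ unseparated f ts → (∃[ i ] Distinct (colours (lookup fs i) t)) ⊎ t List.∈ rest) →
             ∀ {t} → t List.∈ ts → (∃[ i ] Distinct (colours (lookup (f ∷ fs) i) t)) ⊎ t List.∈ rest
    cover′ f fs cover {t} t∈ with distinct? (colours f t)
    ... | yes d = inj₁ (zero , d)
    ... | no ¬d = map₁ (λ (i , d) → suc i , d) (cover (∈-filter⁺ (λ t → ¬? (distinct? (colours f t))) t∈ ¬d))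

  triples : ∀ n → List (Triple n)
  triples n = cartesianProduct (allFin n) (cartesianProduct (allFin n) (allFin n))

  distinctTriples : ∀ n → List (Triple n)
  distinctTriples n = filter distinct? (triples n)

  length-distinctTriples : ∀ n → length (distinctTriples n) ≤ n * (n * n)
  length-distinctTriples n = ≤-trans (length-filter distinct? (triples n)) (≤-reflexive
    (trans (length-cartesianProduct (allFin n) (cartesianProduct (allFin n) (allFin n)))
      (cong₂ _*_ length-allFin
        (trans (length-cartesianProduct (allFin n) (allFin n)) (cong₂ _*_ length-allFin length-allFin)))))
    where
    length-allFin : length (allFin n) ≡ n
    length-allFin = length-tabulate id

  -- There are at most n^3 triples to begin with, so fewer than one is left after `K` maps.
  separatesAll : ∀ K n → n * (n * n) * 7 ^ K < 9 ^ K →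
                 Σ[ fs ∈ Vec (Vec (Fin 3) n) K ] (∀ t → Distinct t → ∃[ i ] Distinct (colours (lookup fs i) t))
  separatesAll K n small =
    let fs , rest , le , cover = separatingFamily K n (distinctTriples n) (all-filter distinct? (triples n))
    in fs , λ t d → [ id , (λ t∈ → contradiction t∈ (empty (9 ^ K) (7 ^ K) rest small le)) ]′
         (cover (∈-filter⁺ distinct? (∈-cartesianProduct⁺ (∈-allFin _) (∈-cartesianProduct⁺ (∈-allFin _) (∈-allFin _))) d))
    where
    open ≤-Reasoning
    empty : ∀ p q (rest : List (Triple n)) → n * (n * n) * q < p → p * length rest ≤ q * length (distinctTriples n) →
            ∀ {t} → ¬ t List.∈ rest
    empty p q (u ∷ rest) small le _ = <-irrefl refl (begin-strict
      n * (n * n) * q                 <⟨ small ⟩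
      p                               ≤⟨ m≤m*n p (suc (length rest)) ⟩
      p * suc (length rest)           ≤⟨ le ⟩
      q * length (distinctTriples n)  ≤⟨ *-monoʳ-≤ q (length-distinctTriples n) ⟩
      q * (n * (n * n))               ≡⟨ *-comm q _ ⟩
      n * (n * n) * q                 ∎)

  card-0⇒empty : ∀ {n} {s : Subset n} → card s ≡ 0 → ∀ {x} → x ∉ s
  card-0⇒empty {s = outside ∷ s} |s|≡0 (there x∈) = card-0⇒empty |s|≡0 x∈

  -- Splits off the smallest element. Three applications list the elements of a 3-set.
  pop : ∀ {n m} (s : Subset n) → card s ≡ suc m →
        Σ[ x ∈ Fin n ] Σ[ s′ ∈ Subset n ] card s′ ≡ m × x ∈ s × x ∉ s′ × s′ ⊆ s × (∀ {w} → w ∈ s → w ≡ x ⊎ w ∈ s′)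
  pop (inside ∷ s) |s|≡ =
    zero , outside ∷ s , suc-injective |s|≡ , here , (λ ()) , (λ { (there w∈) → there w∈ }) ,
    λ { here → inj₁ refl ; (there w∈) → inj₂ (there w∈) }
  pop (outside ∷ s) |s|≡ with x , s′ , |s′|≡ , x∈ , x∉ , s′⊆s , cover ← pop s |s|≡ =
    suc x , outside ∷ s′ , |s′|≡ , there x∈ , x∉ ∘ drop-there , s⊆s s′⊆s ,
    λ { (there w∈) → [ inj₁ ∘ cong suc , inj₂ ∘ there ]′ (cover w∈) }

  Rainbow : ∀ {r n} → Vec (Fin r) n → Subset n → Set
  Rainbow f s = ∀ x y → x ∈ s → y ∈ s → lookup f x ≡ lookup f y → x ≡ y

  rainbow? : ∀ {r n} (f : Vec (Fin r) n) s → Dec (Rainbow f s)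
  rainbow? f s = all? λ x → all? λ y → x ∈? s →-dec y ∈? s →-dec lookup f x ≟ lookup f y →-dec x ≟ y

  triple⇒rainbow : ∀ {n} (s : Subset n) → card s ≡ 3 →
    Σ[ t ∈ Triple n ] Distinct t × (∀ {r} (f : Vec (Fin r) n) → Distinct (colours f t) → Rainbow f s)
  triple⇒rainbow s |s|≡3
    with x , s₁ , |s₁|≡2 , _  , x∉ , _     , cover₁ ← pop s |s|≡3
    with y , s₂ , |s₂|≡1 , y∈ , y∉ , s₂⊆s₁ , cover₂ ← pop s₁ |s₁|≡2
    with z , s₃ , |s₃|≡0 , z∈ , _  , _     , cover₃ ← pop s₂ |s₂|≡1 =
    (x , y , z) , (≢ x∉ y∈ , ≢ x∉ (s₂⊆s₁ z∈) , ≢ y∉ z∈) , rainbow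
    where
    ≢ : ∀ {u v s} → u ∉ s → v ∈ s → u ≢ v
    ≢ u∉ v∈ refl = u∉ v∈
    cover : ∀ {w} → w ∈ s → w ≡ x ⊎ w ≡ y ⊎ w ≡ z
    cover w∈ with cover₁ w∈
    ... | inj₁ e = inj₁ e
    ... | inj₂ w∈₁ with cover₂ w∈₁
    ... | inj₁ e = inj₂ (inj₁ e)
    ... | inj₂ w∈₂ with cover₃ w∈₂
    ... | inj₁ e = inj₂ (inj₂ e)
    ... | inj₂ w∈₃ = contradiction w∈₃ (card-0⇒empty |s₃|≡0)
    rainbow : ∀ {r} (f : Vec (Fin r) _) → Distinct (colours f (x , y , z)) → Rainbow f s
    rainbow f (x≢y , x≢z , y≢z) u v u∈ v∈ fu≡fv with cover u∈ | cover v∈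
    ... | inj₁ refl        | inj₁ refl        = refl
    ... | inj₁ refl        | inj₂ (inj₁ refl) = contradiction fu≡fv x≢y
    ... | inj₁ refl        | inj₂ (inj₂ refl) = contradiction fu≡fv x≢z
    ... | inj₂ (inj₁ refl) | inj₁ refl        = contradiction (sym fu≡fv) x≢y
    ... | inj₂ (inj₁ refl) | inj₂ (inj₁ refl) = refl
    ... | inj₂ (inj₁ refl) | inj₂ (inj₂ refl) = contradiction fu≡fv y≢z
    ... | inj₂ (inj₂ refl) | inj₁ refl        = contradiction (sym fu≡fv) x≢z
    ... | inj₂ (inj₂ refl) | inj₂ (inj₁ refl) = contradiction (sym fu≡fv) y≢z
    ... | inj₂ (inj₂ refl) | inj₂ (inj₂ refl) = refl

  -- Each 3-set is coloured by the index of a map that is injective on it, so every colour class is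
  -- 3-partite.
  noBergeK₄ : ∀ {k n} (fs : Vec (Vec (Fin 3) n) (suc k)) →
              (∀ s → card s ≡ 3 → ∃[ i ] Rainbow (lookup fs i) s) →
              Σ[ g ∈ (Subset n → Fin (suc k)) ] ¬ HasBergeK₄ g
  noBergeK₄ {k} {n} fs separates = g , ¬berge
    where
    g : Subset n → Fin (suc k)
    g s with any? (λ i → rainbow? (lookup fs i) s)
    ... | yes (i , _) = i
    -- A default value that no 3-set receives, by `separates`.
    ... | no  _       = zero

    g-rainbow : ∀ s → card s ≡ 3 → Rainbow (lookup fs (g s)) s
    g-rainbow s |s|≡3 with any? (λ i → rainbow? (lookup fs i) s)
    ... | yes (_ , rainbow) = rainbow
    ... | no  none          = contradiction (separates s |s|≡3) none

    ¬berge : ¬ HasBergeK₄ g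
    ¬berge (i , φ , es , inj , _ , col , inc , _)
      -- Two of the four core vertices lie in one part of the map with index `i`, yet their common
      -- hyperedge has colour `i` and is rainbow for that map.
      with x , y , x<y , same ← pigeonhole ≤-refl (λ x → lookup (lookup fs i) (lookup φ x))
      with x≢y ← <⇒≢ x<y
      with |e|≡3 , ge≡i ← col x y x≢y =
      x≢y (inj x y (subst (λ j → Rainbow (lookup fs j) _) ge≡i (g-rainbow _ |e|≡3) _ _
        (proj₁ (inc x y x≢y)) (proj₂ (inc x y x≢y)) same))

  ^-distribʳ-* : ∀ k m n → (m * n) ^ k ≡ m ^ k * n ^ k
  ^-distribʳ-* zero    m n = refl
  ^-distribʳ-* (suc k) m n = trans (cong (m * n *_) (^-distribʳ-* k m n)) ([m*n]*[o*p]≡[m*o]*[n*p] m n (m ^ k) (n ^ k))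

  -- Cubing the hypothesis gives 729^K ≤ n^9 343^K, and 729 ≥ 686 = 2 · 343. This is the source of
  -- the constant c = 1/9.
  2^K≤n^9 : ∀ K n → 9 ^ K ≤ n * (n * n) * 7 ^ K → 2 ^ K ≤ n ^ 9
  2^K≤n^9 K n le = *-cancelʳ-≤ _ _ (343 ^ K) {{m^n≢0 343 K}} (begin
    2 ^ K * 343 ^ K            ≡⟨ ^-distribʳ-* K 2 343 ⟨
    686 ^ K                    ≤⟨ ^-monoˡ-≤ K (m≤m+n 686 43) ⟩
    729 ^ K                    ≡⟨ cube 9 ⟩
    (9 ^ K) ^ 3                ≤⟨ ^-monoˡ-≤ 3 le ⟩
    (n * (n * n) * 7 ^ K) ^ 3  ≡⟨ ^-distribʳ-* 3 (n * (n * n)) (7 ^ K) ⟩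
    (n * (n * n)) ^ 3 * (7 ^ K) ^ 3
      ≡⟨ cong (λ s → (n * (n * s)) ^ 3 * (7 ^ K) ^ 3) (sym (*-identityʳ n)) ⟩
    (n ^ 3) ^ 3 * (7 ^ K) ^ 3  ≡⟨ cong₂ _*_ (^-*-assoc n 3 3) (sym (cube 7)) ⟩
    n ^ 9 * 343 ^ K            ∎)
    where
    open ≤-Reasoning
    cube : ∀ a → (a ^ 3) ^ K ≡ (a ^ K) ^ 3
    cube a = trans (^-*-assoc a 3 K) (trans (cong (a ^_) (*-comm 3 K)) (sym (^-*-assoc a K 3)))

  lowerBound : ∀ {k n} → RamseyBerge (suc k) n → 2 ^ suc k ≤ n ^ 9
  lowerBound {k} {n} ramsey = 2^K≤n^9 (suc k) n (≮⇒≥ notSmall)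
    where
    notSmall : ¬ n * (n * n) * 7 ^ suc k < 9 ^ suc k
    notSmall small =
      let fs , separates = separatesAll (suc k) n small
          g , ¬berge = noBergeK₄ fs (λ s |s|≡3 →
            let t , d , rainbow = triple⇒rainbow s |s|≡3
                i , d′ = separates t d
            in i , rainbow (lookup fs i) d′)
      in ¬berge (ramsey g)

-- Upper bound: hitting the monochromatic triangles and partitioning the vertices.

module UpperBound where

  open Averaging
  open Configurations
  open import Data.Fin.Base using (Fin; zero; suc)
  open import Data.Fin.Properties using (_≟_; any?; all?)
  open import Data.Fin.Subset using (⁅_⁆)
  open import Data.Fin.Subset.Properties using (∪-comm)
  open import Data.List.Base using (List; []; _∷_; length; filter; map; allFin; cartesianProduct)
  open import Data.List.Membership.Propositional using (_∈_; _∉_)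
  open import Data.List.Membership.Propositional.Properties
    using (∈-filter⁺; ∈-filter⁻; ∈-cartesianProduct⁺; ∈-allFin; ∈-map⁺)
  open import Data.List.Properties using (length-tabulate; length-map; filter-all; filter-notAll)
  open import Data.List.Relation.Unary.All as All using (All; []; _∷_)
  open import Data.List.Relation.Unary.Any as Any using (here; there)
  open import Data.List.Relation.Unary.AllPairs using ([]; _∷_)
  open import Data.List.Relation.Unary.Unique.Propositional using (Unique)
  open import Data.List.Relation.Unary.Unique.Propositional.Properties using (allFin⁺; filter⁺)
  open import Data.Nat.Base using (ℕ; zero; suc; _+_; _*_; _≤_; _<_; s≤s; z≤n; s≤s⁻¹; NonZero)
  open import Data.Nat.Properties hiding (_≟_)
  open import Data.Nat.Tactic.RingSolver using (solve-∀)
  open import Data.Product.Base using (Σ-syntax; ∃; ∃-syntax; _×_; _,_; proj₁; proj₂)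
  open import Data.Sum.Base using (_⊎_; inj₁; inj₂; [_,_]′)
  open import Data.Vec.Base as Vec using (Vec; lookup)
  open import Data.Vec.Relation.Unary.All as VecAll using () renaming ([] to []ᵃ; _∷_ to _∷ᵃ_)
  import Data.Vec.Relation.Unary.All.Properties as VecAllP
  open import Data.Vec.Relation.Unary.AllPairs using () renaming ([] to []ᵖ; _∷_ to _∷ᵖ_)
  open import Function.Base using (_∘_; id)
  open import Relation.Binary.PropositionalEquality
    using (_≡_; _≢_; refl; sym; trans; cong; cong₂; subst₂; ≢-sym; module ≡-Reasoning)
  open import Relation.Nullary.Decidable
    using (Dec; yes; no; map′; _×-dec_; _⊎-dec_; _→-dec_; ¬?; decidable-stable)
  open import Relation.Nullary.Negation using (¬_; contradiction)
  open import Algebra.Properties.Semiring.Sum +-*-semiring using (sum-syntax; sum-cong-≗)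

  module _ {A : Set} {P Q : A → Set} (P? : ∀ x → Dec (P x)) (Q? : ∀ x → Dec (Q x)) where

    length-filter-filter : ∀ xs → length (filter P? (filter Q? xs)) ≤ length (filter P? xs)
    length-filter-filter [] = z≤n
    length-filter-filter (x ∷ xs) with Q? x
    ... | no  _ = ≤-trans (length-filter-filter xs) (≤-trans (m≤n+m _ (ind (P? x)))
                    (≤-reflexive (sym (length-filter-∷ P? x xs))))
    ... | yes _ = subst₂ _≤_ (sym (length-filter-∷ P? x _)) (sym (length-filter-∷ P? x xs))
                    (+-monoʳ-≤ (ind (P? x)) (length-filter-filter xs))

  length-filter-¬ : ∀ {A : Set} {P : A → Set} (P? : ∀ x → Dec (P x)) xs →
                    length xs ≡ length (filter P? xs) + length (filter (¬? ∘ P?) xs)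
  length-filter-¬ P? [] = refl
  length-filter-¬ P? (x ∷ xs) with P? x
  ... | yes _ = cong suc (length-filter-¬ P? xs)
  ... | no  _ = trans (cong suc (length-filter-¬ P? xs)) (sym (+-suc _ _))

  -- Peels off one value of `h` at a time. It serves both for the colour classes at a vertex and for
  -- the parts of a partition.
  length≤fibres : ∀ {A : Set} {m} (h : A → Fin m) {M} J (xs : List A) → (∀ {x} → x ∈ xs → h x ∈ J) →
                  (∀ {j} → j ∈ J → length (filter (λ x → h x ≟ j) xs) ≤ M) → length xs ≤ length J * M
  length≤fibres h []      []       _  _     = z≤n
  length≤fibres h []      (x ∷ xs) h∈ _     with () ← h∈ (here refl)
  length≤fibres h {M} (j ∷ J) xs   h∈ fibre = begin
    length xs                                ≡⟨ length-filter-¬ (λ x → h x ≟ j) xs ⟩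
    length (filter (λ x → h x ≟ j) xs) + length rest
                                             ≤⟨ +-mono-≤ (fibre (here refl)) (length≤fibres h J rest h∈′ fibre′) ⟩
    M + length J * M                         ∎
    where
    open ≤-Reasoning
    rest = filter (λ x → ¬? (h x ≟ j)) xs
    h∈′ : ∀ {x} → x ∈ rest → h x ∈ J
    h∈′ x∈ with x∈xs , hx≢j ← ∈-filter⁻ (λ x → ¬? (h x ≟ j)) x∈ with h∈ x∈xs
    ... | here hx≡j = contradiction hx≡j hx≢j
    ... | there hx∈ = hx∈
    fibre′ : ∀ {i} → i ∈ J → length (filter (λ x → h x ≟ i) rest) ≤ M
    fibre′ i∈ = ≤-trans (length-filter-filter (λ x → h x ≟ _) (λ x → ¬? (h x ≟ j)) xs) (fibre (there i∈))

  length-allFin : ∀ n → length (allFin n) ≡ n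
  length-allFin n = length-tabulate id

  delete : ∀ {n} → Fin n → List (Fin n) → List (Fin n)
  delete d = filter (λ x → ¬? (x ≟ d))

  deleteAll : ∀ {n} → List (Fin n) → List (Fin n) → List (Fin n)
  deleteAll []       xs = xs
  deleteAll (d ∷ ds) xs = delete d (deleteAll ds xs)

  deleteAll-unique : ∀ {n} (ds : List (Fin n)) {xs} → Unique xs → Unique (deleteAll ds xs)
  deleteAll-unique []       u = u
  deleteAll-unique (d ∷ ds) u = filter⁺ (λ x → ¬? (x ≟ d)) (deleteAll-unique ds u)

  ∉-deleted : ∀ {n} (ds : List (Fin n)) {xs x} → x ∈ deleteAll ds xs → x ∉ ds
  ∉-deleted (d ∷ ds) {xs} x∈ x∈ds with x∈′ , x≢d ← ∈-filter⁻ (λ x → ¬? (x ≟ d)) {xs = deleteAll ds xs} x∈ with x∈ds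
  ... | here x≡d    = x≢d x≡d
  ... | there x∈ds′ = ∉-deleted ds x∈′ x∈ds′

  -- At most one entry of a duplicate-free list equals `d`.
  length-delete : ∀ {n} (d : Fin n) {xs} → Unique xs → length xs ≤ suc (length (delete d xs))
  length-delete d [] = z≤n
  length-delete d {x ∷ xs} (x∉xs ∷ u) with x ≟ d
  ... | yes refl = s≤s (≤-reflexive (cong length (sym (filter-all (λ x → ¬? (x ≟ d)) (All.map ≢-sym x∉xs)))))
  ... | no  _    = s≤s (length-delete d u)

  length-deleteAll : ∀ {n} (ds : List (Fin n)) {xs} → Unique xs → length xs ≤ length ds + length (deleteAll ds xs)
  length-deleteAll []       u = ≤-refl
  length-deleteAll (d ∷ ds) {xs} u = begin
    length xs                                          ≤⟨ length-deleteAll ds u ⟩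
    length ds + length (deleteAll ds xs)               ≤⟨ +-monoʳ-≤ (length ds) (length-delete d (deleteAll-unique ds u)) ⟩
    length ds + suc (length (deleteAll (d ∷ ds) xs))   ≡⟨ +-suc (length ds) _ ⟩
    suc (length ds + length (deleteAll (d ∷ ds) xs))   ∎
    where open ≤-Reasoning

  -- Picks one `t` for each `p` that admits any. It is applied with `ps` the list of the n k pairs
  -- of a vertex and a colour.
  representatives : ∀ {P T : Set} {Q : P → T → Set} → (∀ p → Dec (∃ (Q p))) → ∀ ps →
    Σ[ ts ∈ List T ] length ts ≤ length ps × All (λ t → ∃[ p ] Q p t) ts ×
      (∀ {p t} → p ∈ ps → Q p t → ∃[ t′ ] t′ ∈ ts × Q p t′)
  representatives Q? [] = [] , z≤n , [] , λ ()
  representatives Q? (p ∷ ps) with ts , len , sound , complete ← representatives Q? ps | Q? p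
  ... | yes (t , q) = t ∷ ts , s≤s len , (p , q) ∷ sound ,
    λ { (here refl) _ → t , here refl , q
      ; (there p∈)  q → let t′ , t′∈ , q′ = complete p∈ q in t′ , there t′∈ , q′ }
  ... | no ¬q = ts , m≤n⇒m≤1+n len , sound ,
    λ { (here refl) q → contradiction (_ , q) ¬q ; (there p∈) q → complete p∈ q }

  -- k! Σ_{j ≤ k} 1/j!
  triangleBound : ℕ → ℕ
  triangleBound zero    = 1
  triangleBound (suc j) = suc (suc j * triangleBound j)

  module _ {n k : ℕ} (χ : Fin n → Fin n → Fin k) (χ-sym : ∀ x y → χ x y ≡ χ y x) where

    MonoTriangle : Fin k → Triple n → Set
    MonoTriangle i t@(x , y , z) = Distinct t × χ x y ≡ i × χ x z ≡ i × χ y z ≡ i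

    TriangleFree : List (Fin n) → Set
    TriangleFree xs = ∀ {x y z i} → x ∈ xs → y ∈ xs → z ∈ xs → ¬ MonoTriangle i (x , y , z)

    -- The classical induction for multicolour triangles, with `J` the list of colours still
    -- allowed: the neighbours of `x` in colour i span no edge of colour i, so one colour fewer is
    -- left among them.
    triangleFree-bound : ∀ j J xs → length J ≤ j → Unique xs → (∀ {x y} → x ∈ xs → y ∈ xs → x ≢ y → χ x y ∈ J) →
                         TriangleFree xs → length xs ≤ triangleBound j
    triangleFree-bound j       J  []           _ _ _ _ = z≤n
    triangleFree-bound zero    [] (x ∷ [])     _ _ _ _ = ≤-refl
    triangleFree-bound zero    [] (x ∷ y ∷ xs) _ ((x≢y ∷ _) ∷ _) χ∈ _ with () ← χ∈ (here refl) (there (here refl)) x≢y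
    triangleFree-bound (suc j) J  (x ∷ xs)     |J|≤ (x∉xs ∷ u) χ∈ free = s≤s (begin
      length xs      ≤⟨ length≤fibres (χ x) J xs (λ y∈ → χ∈ (here refl) (there y∈) (All.lookup x∉xs y∈)) neighbours ⟩
      length J * triangleBound j ≤⟨ *-monoˡ-≤ (triangleBound j) |J|≤ ⟩
      suc j * triangleBound j    ∎)
      where
      open ≤-Reasoning
      neighbours : ∀ {i} → i ∈ J → length (filter (λ y → χ x y ≟ i) xs) ≤ triangleBound j
      neighbours {i} i∈J =
        triangleFree-bound j (filter (λ c → ¬? (c ≟ i)) J) (filter χx? xs)
          (s≤s⁻¹ (≤-trans (filter-notAll (λ c → ¬? (c ≟ i)) J (Any.map (λ e ne → ne (sym e)) i∈J)) |J|≤))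
          (filter⁺ χx? u)
          (λ y∈ z∈ y≢z →
            let y∈xs , xy = ∈-filter⁻ χx? y∈ ; z∈xs , xz = ∈-filter⁻ χx? z∈ in
            -- If `y` and `z` were joined in colour `i`, they would form a monochromatic triangle
            -- with `x`.
            ∈-filter⁺ (λ c → ¬? (c ≟ i)) (χ∈ (there y∈xs) (there z∈xs) y≢z) λ yz →
              free (here refl) (there y∈xs) (there z∈xs)
                ((All.lookup x∉xs y∈xs , All.lookup x∉xs z∈xs , y≢z) , xy , xz , yz))
          (λ x∈ y∈ z∈ → free (there (proj₁ (∈-filter⁻ χx? x∈))) (there (proj₁ (∈-filter⁻ χx? y∈)))
                             (there (proj₁ (∈-filter⁻ χx? z∈))))
        where
        χx? : ∀ y → Dec (χ x y ≡ i)
        χx? y = χ x y ≟ i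

    -- The first vertex has degree 2 in colour `i`; together with the colour it thus determines the
    -- triangle up to the order of `a` and `b`.
    Low : Fin k → Triple n → Set
    Low i t@(v , a , b) = MonoTriangle i t × (∀ w → w ≢ v → χ v w ≡ i → w ≡ a ⊎ w ≡ b)

    low? : ∀ i t → Dec (Low i t)
    low? i (v , a , b) =
      ((¬? (v ≟ a) ×-dec ¬? (v ≟ b) ×-dec ¬? (a ≟ b)) ×-dec χ v a ≟ i ×-dec χ v b ≟ i ×-dec χ a b ≟ i) ×-dec
      (all? λ w → ¬? (w ≟ v) →-dec χ v w ≟ i →-dec (w ≟ a ⊎-dec w ≟ b))

    module _ (noStar : ¬ HasStar χ) where

      Further : Fin k → Triple n → Set
      Further i (v , a , b) = ∃[ w ] (w ≢ v × w ≢ a × w ≢ b) × χ v w ≡ i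

      further? : ∀ i t → Dec (Further i t)
      further? i (v , a , b) = any? λ w → (¬? (w ≟ v) ×-dec ¬? (w ≟ a) ×-dec ¬? (w ≟ b)) ×-dec χ v w ≟ i

      ¬further⇒low : ∀ {i t} → MonoTriangle i t → ¬ Further i t → Low i t
      ¬further⇒low {i} {v , a , b} mono ¬further = mono , λ w w≢v vw → decidable-stable (w ≟ a ⊎-dec w ≟ b)
        λ ¬ab → ¬further (w , (w≢v , ¬ab ∘ inj₁ , ¬ab ∘ inj₂) , vw)

      -- Otherwise each vertex has a further neighbour in colour `i`, and these three edges complete
      -- the triangle to a star.
      ∃-low : ∀ {i x y z} → MonoTriangle i (x , y , z) → Low i (x , y , z) ⊎ Low i (y , x , z) ⊎ Low i (z , x , y)
      ∃-low {i} {x} {y} {z} mono@((x≢y , x≢z , y≢z) , xy , xz , yz)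
        with further? i (x , y , z) | further? i (y , x , z) | further? i (z , x , y)
      ... | no ¬f | _     | _     = inj₁ (¬further⇒low mono ¬f)
      ... | yes _ | no ¬f | _     = inj₂ (inj₁ (¬further⇒low
        ((≢-sym x≢y , y≢z , x≢z) , trans (χ-sym y x) xy , yz , xz) ¬f))
      ... | yes _ | yes _ | no ¬f = inj₂ (inj₂ (¬further⇒low
        ((≢-sym x≢z , ≢-sym y≢z , x≢y) , trans (χ-sym z x) xz , trans (χ-sym z y) yz , xy) ¬f))
      ... | yes (u , (u≢x , u≢y , u≢z) , xu) | yes (v , (v≢y , v≢x , v≢z) , yv) | yes (w , (w≢z , w≢x , w≢y) , zw) =
        contradiction (i , qs , rs , distinct , outside , rim , spokes) noStar
        where
        qs rs : Vec (Fin n) 3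
        qs = x Vec.∷ y Vec.∷ z Vec.∷ Vec.[]
        rs = u Vec.∷ v Vec.∷ w Vec.∷ Vec.[]
        distinct : ∀ a b → a ≢ b → lookup qs a ≢ lookup qs b
        distinct _ _ = lookupPair {R = _≢_} ≢-sym ((x≢y ∷ᵃ x≢z ∷ᵃ []ᵃ) ∷ᵖ (y≢z ∷ᵃ []ᵃ) ∷ᵖ []ᵃ ∷ᵖ []ᵖ)
        rim : ∀ a b → a ≢ b → χ (lookup qs a) (lookup qs b) ≡ i
        rim _ _ = lookupPair {R = λ a b → χ a b ≡ i} (λ {a} {b} ab → trans (χ-sym b a) ab)
                    ((xy ∷ᵃ xz ∷ᵃ []ᵃ) ∷ᵖ (yz ∷ᵃ []ᵃ) ∷ᵖ []ᵃ ∷ᵖ []ᵖ)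
        outside : ∀ a b → lookup rs a ≢ lookup qs b
        outside a = VecAllP.lookup⁺ (VecAllP.lookup⁺ {P = λ r → VecAll.All (r ≢_) qs}
          ((u≢x ∷ᵃ u≢y ∷ᵃ u≢z ∷ᵃ []ᵃ) ∷ᵃ (v≢x ∷ᵃ v≢y ∷ᵃ v≢z ∷ᵃ []ᵃ) ∷ᵃ (w≢x ∷ᵃ w≢y ∷ᵃ w≢z ∷ᵃ []ᵃ) ∷ᵃ []ᵃ) a)
        spokes : ∀ a → χ (lookup qs a) (lookup rs a) ≡ i
        spokes zero             = xu
        spokes (suc zero)       = yv
        spokes (suc (suc zero)) = zw

      -- Says that `a`, `b`, `c` all occur among `x`, `y`, `z`, in whatever order, in the form in
      -- which it is applied: a property of the latter three passes to the former.
      Covers : Triple n → Triple n → Set₁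
      Covers (x , y , z) (a , b , c) = ∀ {P : Fin n → Set} → P x → P y → P z → P a × P b × P c

      -- A vertex is low in at most one triangle of each colour, whence the bound n k.
      hittingTriples : Σ[ ts ∈ List (Triple n) ] length ts ≤ n * k × All Distinct ts ×
                       (∀ {i t} → MonoTriangle i t → ∃[ t′ ] t′ ∈ ts × Covers t t′)
      hittingTriples =
        ts ,
        ≤-trans (proj₁ (proj₂ reps)) (≤-reflexive (trans (length-cartesianProduct (allFin n) (allFin k))
                                                         (cong₂ _*_ (length-allFin n) (length-allFin k)))) ,
        All.map (λ { (_ , _ , (distinct , _) , _) → distinct }) (proj₁ (proj₂ (proj₂ reps))) ,
        λ mono → [ hitLow ,
          [ (λ low → let t , t∈ , cover = hitLow low in t , t∈ , λ {P} px py pz → cover {P} py px pz) ,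
            (λ low → let t , t∈ , cover = hitLow low in t , t∈ , λ {P} px py pz → cover {P} pz px py) ]′ ]′ (∃-low mono)
        where
        LowAt : Fin n × Fin k → Triple n → Set
        LowAt (v , i) t = proj₁ t ≡ v × Low i t
        lowAt? : ∀ p → Dec (∃ (LowAt p))
        lowAt? (v , i) = map′ (λ (a , b , low) → (v , a , b) , refl , low) (λ { ((_ , a , b) , refl , low) → a , b , low })
                           (any? λ a → any? λ b → low? i (v , a , b))
        reps = representatives lowAt? (cartesianProduct (allFin n) (allFin k))
        ts = proj₁ reps
        -- The representative chosen for `x` and `i` is also a triangle of colour `i` at `x`; as `x`
        -- has no other neighbours in this colour, its remaining vertices are among `y` and `z`.
        hitLow : ∀ {i t} → Low i t → ∃[ t′ ] t′ ∈ ts × Covers t t′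
        hitLow {i} {x , y , z} low@(_ , only)
          with (_ , a , b) , t∈ , refl , ((x≢a , x≢b , _) , xa , xb , _) , _
               ← proj₂ (proj₂ (proj₂ reps)) (∈-cartesianProduct⁺ (∈-allFin x) (∈-allFin i)) (refl , low) =
          (x , a , b) , t∈ , λ {P} px py pz → px ,
            choose {P} (only a (≢-sym x≢a) xa) py pz , choose {P} (only b (≢-sym x≢b) xb) py pz
          where
          choose : ∀ {P : Fin n → Set} {w} → w ≡ y ⊎ w ≡ z → P y → P z → P w
          choose (inj₁ refl) py _ = py
          choose (inj₂ refl) _ pz = pz

  -- Random partition into r parts.

  Monochromatic : ∀ {r} → Triple r → Set
  Monochromatic (a , b , c) = a ≡ b × a ≡ c

  monochromatic? : ∀ {r} (t : Triple r) → Dec (Monochromatic t)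
  monochromatic? (a , b , c) = a ≟ b ×-dec a ≟ c

  -- Hence three distinct points fall into a common part with probability 1/r^2.
  #monochromatic : ∀ r → #bad (monochromatic? {r}) ≡ r
  #monochromatic r = begin
    ∑[ a < r ] ∑[ b < r ] ∑[ c < r ] ind (a ≟ b ×-dec a ≟ c)    ≡⟨ sum-cong-≗ (λ a → sum-cong-≗ (λ b → inner a b)) ⟩
    ∑[ a < r ] ∑[ b < r ] ind (a ≟ b)                           ≡⟨ sum-cong-≗ {r} ∑-diagonal ⟩
    ∑[ a < r ] 1                                                ≡⟨ trans (∑-const r 1) (*-identityʳ r) ⟩
    r                                                           ∎
    where
    open ≡-Reasoning
    ∑-zero : ∀ m → ∑[ b < m ] 0 ≡ 0
    ∑-zero m = trans (∑-const m 0) (*-zeroʳ m)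
    ∑-diagonal : ∀ {m} (a : Fin m) → ∑[ b < m ] ind (a ≟ b) ≡ 1
    ∑-diagonal {suc m} zero    = cong suc (∑-zero m)
    ∑-diagonal {suc m} (suc a) = ∑-diagonal a
    inner : ∀ a b → ∑[ c < r ] ind (a ≟ b ×-dec a ≟ c) ≡ ind (a ≟ b)
    inner a b with a ≟ b
    ... | yes _ = ∑-diagonal a
    ... | no  _ = ∑-zero r

  cancel-cube : ∀ r .{{_ : NonZero r}} b l m N → b ≡ r → r * (r * (r * l)) ≤ m * b → m ≤ N → r * (r * l) ≤ N
  cancel-cube r _ l m N refl le m≤N = *-cancelˡ-≤ r (begin
    r * (r * (r * l))  ≤⟨ le ⟩
    m * r              ≤⟨ *-monoˡ-≤ r m≤N ⟩
    N * r              ≡⟨ *-comm N r ⟩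
    r * N              ∎)
    where open ≤-Reasoning

  -- The first two inequalities give 2 b ≤ n, so the b deleted vertices make up at most half of all
  -- n.
  absorb : ∀ r n k .{{_ : NonZero k}} m b → 2 * k ≤ r * r → r * (r * b) ≤ n * k → n ≤ m + b → n ≤ 2 * m
  absorb r n k m b 2k≤r² r²b≤nk n≤m+b = +-cancelʳ-≤ n n (2 * m) (begin
    n + n            ≤⟨ +-mono-≤ n≤m+b n≤m+b ⟩
    m + b + (m + b)  ≡⟨ regroup m b ⟩
    2 * m + 2 * b    ≤⟨ +-monoʳ-≤ (2 * m) (*-cancelˡ-≤ k 2bk≤nk) ⟩
    2 * m + n        ∎)
    where
    open ≤-Reasoning
    regroup : ∀ m b → m + b + (m + b) ≡ 2 * m + 2 * b
    regroup = solve-∀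
    rotate : ∀ k b → k * (2 * b) ≡ 2 * k * b
    rotate = solve-∀
    2bk≤nk : k * (2 * b) ≤ k * n
    2bk≤nk = begin
      k * (2 * b)  ≡⟨ rotate k b ⟩
      2 * k * b    ≤⟨ *-monoˡ-≤ b 2k≤r² ⟩
      r * r * b    ≡⟨ *-assoc r r b ⟩
      r * (r * b)  ≤⟨ r²b≤nk ⟩
      n * k        ≡⟨ *-comm n k ⟩
      k * n        ∎

  module _ {n k : ℕ} (χ : Fin n → Fin n → Fin k) (χ-sym : ∀ x y → χ x y ≡ χ y x) (noStar : ¬ HasStar χ) where

    module _ (r : ℕ) .{{_ : NonZero r}} (ts : List (Triple n)) (f : Vec (Fin r) n) where

      bad : List (Triple n)
      bad = filter (λ t → monochromatic? (colours f t)) ts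

      kept : List (Fin n)
      kept = deleteAll (map proj₁ bad) (allFin n)

      -- A monochromatic triangle within a part would cover a triple of `ts` inside that part. This
      -- triple is bad, so its first vertex has been deleted.
      part-bound : (∀ {i t} → MonoTriangle χ χ-sym i t → ∃[ t′ ] t′ ∈ ts × Covers χ χ-sym noStar t t′) →
                   ∀ a → length (filter (λ v → lookup f v ≟ a) kept) ≤ triangleBound k
      part-bound hits a = triangleFree-bound χ χ-sym k (allFin k) part (≤-reflexive (length-allFin k))
        (filter⁺ f? (deleteAll-unique (map proj₁ bad) (allFin⁺ n))) (λ _ _ _ → ∈-allFin _) free
        where
        f? = λ v → lookup f v ≟ a
        part = filter f? kept
        free : TriangleFree χ χ-sym part
        free x∈ y∈ z∈ mono =
          let (u , v , w) , t∈ , cover = hits mono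
              u∈ , v∈ , w∈ = cover {_∈ part} x∈ y∈ z∈
              u∈kept , fu = ∈-filter⁻ f? u∈
              _ , fv = ∈-filter⁻ f? {xs = kept} v∈
              _ , fw = ∈-filter⁻ f? {xs = kept} w∈
          in ∉-deleted (map proj₁ bad) u∈kept
               (∈-map⁺ proj₁ (∈-filter⁺ (λ t → monochromatic? (colours f t)) t∈ (trans fu (sym fv) , trans fu (sym fw))))

      covering-bound : ∀ m → (∀ a → length (filter (λ v → lookup f v ≟ a) kept) ≤ m) → n ≤ r * m + length bad
      covering-bound m part≤m = begin
        n                                     ≡⟨ length-allFin n ⟨
        length (allFin n)                     ≤⟨ length-deleteAll (map proj₁ bad) (allFin⁺ n) ⟩
        length (map proj₁ bad) + length kept  ≡⟨ cong (_+ length kept) (length-map proj₁ bad) ⟩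
        length bad + length kept              ≤⟨ +-monoʳ-≤ (length bad)
          (length≤fibres (lookup f) (allFin r) kept (λ _ → ∈-allFin _) (λ _ → part≤m _)) ⟩
        length bad + length (allFin r) * m    ≡⟨ cong (λ l → length bad + l * m) (length-allFin r) ⟩
        length bad + r * m                    ≡⟨ +-comm (length bad) _ ⟩
        r * m + length bad                    ∎
        where open ≤-Reasoning

    partition-bound : ∀ r .{{_ : NonZero r}} → ∃[ b ] r * (r * b) ≤ n * k × n ≤ r * triangleBound k + b
    partition-bound r =
      let ts , len , distinct , hits = hittingTriples χ χ-sym noStar
          f , few = ∃-few-bad monochromatic? n ts distinct
      in length (bad r ts f) ,
         cancel-cube r (#bad (monochromatic? {r})) (length (bad r ts f)) (length ts) (n * k) (#monochromatic r) few len ,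
         covering-bound r ts f (triangleBound k) (part-bound r ts f hits)

    size-bound : ∀ r .{{_ : NonZero r}} .{{_ : NonZero k}} → 2 * k ≤ r * r → n ≤ 2 * (r * triangleBound k)
    size-bound r 2k≤r² =
      let b , r²b≤nk , n≤rM+b = partition-bound r in absorb r n k (r * triangleBound k) b 2k≤r² r²b≤nk n≤rM+b

  -- The contrapositive of `size-bound`; decidability of `HasStar` turns the refuted absence of a
  -- star into a star.
  ramseyGraph-bound : ∀ {k n} r .{{_ : NonZero r}} .{{_ : NonZero k}} →
                      2 * k ≤ r * r → 2 * (r * triangleBound k) < n → RamseyGraph k n
  ramseyGraph-bound r 2k≤r² small g = decidable-stable (hasStar? (onPairs g)) λ noStar →
    <-irrefl refl (<-≤-trans small (size-bound (onPairs g) (λ x y → cong g (∪-comm ⁅ x ⁆ ⁅ y ⁆)) noStar r 2k≤r²))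

-- Rational arithmetic, the choice of r, and the asymptotic bound.

module Asymptotics where

  open Configurations
  open LowerBound
  open UpperBound
  open import Data.Integer.Base as ℤ using (+_)
  import Data.Integer.Properties as ℤ
  open import Data.Nat.Base as ℕ using (ℕ; zero; suc; _!; _∸_; s≤s; z≤n; ⌊_/2⌋)
  open import Data.Nat.Properties as ℕ using (_!≢0)
  open import Data.Nat.Tactic.RingSolver using (solve-∀)
  open import Data.Product.Base using (∃-syntax; _×_; _,_; proj₁; proj₂)
  open import Data.Rational.Base
  open import Data.Rational.Properties
  open import Data.Rational.Unnormalised.Base as ℚᵘ using (mkℚᵘ; *≡*)
  import Data.Rational.Unnormalised.Properties as ℚᵘ
  open import Function.Base using (_∘_)
  open import Relation.Binary.PropositionalEquality
    using (_≡_; refl; sym; trans; cong; cong₂; subst; module ≡-Reasoning)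
  open import Relation.Nullary.Decidable using (yes; no)
  open import Relation.Nullary.Negation using (contradiction)

  fromℕ-≃ : ∀ n → toℚᵘ (fromℕ n) ℚᵘ.≃ mkℚᵘ (+ n) 0
  fromℕ-≃ n = toℚᵘ-fromℚᵘ (mkℚᵘ (+ n) 0)

  fromℕ-+ : ∀ m n → fromℕ (m ℕ.+ n) ≡ fromℕ m + fromℕ n
  fromℕ-+ m n = toℚᵘ-injective (begin
    toℚᵘ (fromℕ (m ℕ.+ n))  ≈⟨ fromℕ-≃ (m ℕ.+ n) ⟩
    mkℚᵘ (+ (m ℕ.+ n)) 0    ≈⟨ *≡* (cong (ℤ._* + 1)
      (cong₂ ℤ._+_ (sym (ℤ.*-identityʳ (+ m))) (sym (ℤ.*-identityʳ (+ n))))) ⟩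
    mkℚᵘ (+ m) 0 ℚᵘ.+ mkℚᵘ (+ n) 0      ≈⟨ ℚᵘ.+-cong (fromℕ-≃ m) (fromℕ-≃ n) ⟨
    toℚᵘ (fromℕ m) ℚᵘ.+ toℚᵘ (fromℕ n)  ≈⟨ toℚᵘ-homo-+ (fromℕ m) (fromℕ n) ⟨
    toℚᵘ (fromℕ m + fromℕ n)                 ∎)
    where open ℚᵘ.≃-Reasoning

  fromℕ-* : ∀ m n → fromℕ (m ℕ.* n) ≡ fromℕ m * fromℕ n
  fromℕ-* m n = toℚᵘ-injective (begin
    toℚᵘ (fromℕ (m ℕ.* n))              ≈⟨ fromℕ-≃ (m ℕ.* n) ⟩
    mkℚᵘ (+ (m ℕ.* n)) 0                ≈⟨ *≡* (cong (ℤ._* + 1) (ℤ.pos-* m n)) ⟩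
    mkℚᵘ (+ m) 0 ℚᵘ.* mkℚᵘ (+ n) 0      ≈⟨ ℚᵘ.*-cong (fromℕ-≃ m) (fromℕ-≃ n) ⟨
    toℚᵘ (fromℕ m) ℚᵘ.* toℚᵘ (fromℕ n)  ≈⟨ toℚᵘ-homo-* (fromℕ m) (fromℕ n) ⟨
    toℚᵘ (fromℕ m * fromℕ n)                 ∎)
    where open ℚᵘ.≃-Reasoning

  fromℕ-nonNeg : ∀ n → NonNegative (fromℕ n)
  fromℕ-nonNeg n = normalize-nonNeg n 1

  p≤p+q : ∀ p q .{{_ : NonNegative q}} → p ≤ p + q
  p≤p+q p q = ≤-trans (≤-reflexive (sym (+-identityʳ p))) (+-monoʳ-≤ p (nonNegative⁻¹ q))

  fromℕ-mono : ∀ {m n} → m ℕ.≤ n → fromℕ m ≤ fromℕ n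
  fromℕ-mono {m} {n} m≤n = subst (fromℕ m ≤_)
    (trans (sym (fromℕ-+ m (n ∸ m))) (cong fromℕ (ℕ.m+[n∸m]≡n m≤n)))
    (p≤p+q (fromℕ m) (fromℕ (n ∸ m)) {{fromℕ-nonNeg (n ∸ m)}})

  1/n*n≡1 : ∀ n .{{_ : ℕ.NonZero n}} → (+ 1 / n) * fromℕ n ≡ 1ℚ
  1/n*n≡1 n@(suc m) = toℚᵘ-injective (begin
    toℚᵘ ((+ 1 / n) * fromℕ n)          ≈⟨ toℚᵘ-homo-* (+ 1 / n) (fromℕ n) ⟩
    toℚᵘ (+ 1 / n) ℚᵘ.* toℚᵘ (fromℕ n)  ≈⟨ ℚᵘ.*-cong (toℚᵘ-fromℚᵘ (mkℚᵘ (+ 1) m)) (fromℕ-≃ n) ⟩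
    mkℚᵘ (+ 1) m ℚᵘ.* mkℚᵘ (+ n) 0      ≈⟨ *≡* (trans (ℤ.*-comm (+ 1 ℤ.* + n) (+ 1))
      (cong (+ 1 ℤ.*_) (ℤ.*-comm (+ 1) (+ n)))) ⟩
    toℚᵘ 1ℚ                             ∎)
    where open ℚᵘ.≃-Reasoning

  e-sum-step : ∀ m → e-sum m ≤ e-sum (suc m)
  e-sum-step m = p≤p+q (e-sum m) ((+ 1 / (suc m !)) {{suc m !≢0}}) {{normalize-nonNeg 1 (suc m !) {{suc m !≢0}}}}

  e-sum-mono : ∀ {k} d → e-sum k ≤ e-sum (d ℕ.+ k)
  e-sum-mono zero    = ≤-refl
  e-sum-mono (suc d) = ≤-trans (e-sum-mono d) (e-sum-step (d ℕ.+ _))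

  -- Passing from k! to (k + 1)! multiplies the old terms by k + 1 and turns the new term 1/(k + 1)!
  -- into 1, which is the recursion of `triangleBound`.
  e-sum*k!≡triangleBound : ∀ k → e-sum k * fromℕ (k !) ≡ fromℕ (triangleBound k)
  e-sum*k!≡triangleBound zero    = refl
  e-sum*k!≡triangleBound (suc k) = begin
    (e-sum k + 1/!) * fromℕ (suc k !)                  ≡⟨ *-distribʳ-+ (fromℕ (suc k !)) (e-sum k) 1/! ⟩
    e-sum k * fromℕ (suc k !) + 1/! * fromℕ (suc k !)  ≡⟨ cong₂ _+_ left (1/n*n≡1 (suc k !) {{suc k !≢0}}) ⟩
    fromℕ (suc k ℕ.* triangleBound k) + 1ℚ             ≡⟨ +-comm (fromℕ (suc k ℕ.* triangleBound k)) 1ℚ ⟩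
    fromℕ 1 + fromℕ (suc k ℕ.* triangleBound k)        ≡⟨ fromℕ-+ 1 (suc k ℕ.* triangleBound k) ⟨
    fromℕ (triangleBound (suc k))                      ∎
    where
    open ≡-Reasoning
    1/! = (+ 1 / (suc k !)) {{suc k !≢0}}
    left : e-sum k * fromℕ (suc k !) ≡ fromℕ (suc k ℕ.* triangleBound k)
    left = begin
      e-sum k * fromℕ (suc k ℕ.* k !)          ≡⟨ cong (λ n → e-sum k * fromℕ n) (ℕ.*-comm (suc k) (k !)) ⟩
      e-sum k * fromℕ (k ! ℕ.* suc k)          ≡⟨ cong (e-sum k *_) (fromℕ-* (k !) (suc k)) ⟩
      e-sum k * (fromℕ (k !) * fromℕ (suc k))  ≡⟨ *-assoc (e-sum k) (fromℕ (k !)) (fromℕ (suc k)) ⟨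
      e-sum k * fromℕ (k !) * fromℕ (suc k)    ≡⟨ cong (_* fromℕ (suc k)) (e-sum*k!≡triangleBound k) ⟩
      fromℕ (triangleBound k) * fromℕ (suc k)  ≡⟨ fromℕ-* (triangleBound k) (suc k) ⟨
      fromℕ (triangleBound k ℕ.* suc k)        ≡⟨ cong fromℕ (ℕ.*-comm (triangleBound k) (suc k)) ⟩
      fromℕ (suc k ℕ.* triangleBound k)        ∎

  -- The o(1) term is 4 for small k and 0 from 14 on: then r parts with
  -- r² ≥ 2k and 2r ≤ k - 2 are available.
  slack : ℕ → ℕ
  slack k with 14 ℕ.≤? k
  ... | yes _ = 0
  ... | no  _ = 4

  slack-large : ∀ {k} → 14 ℕ.≤ k → slack k ≡ 0
  slack-large {k} 14≤k with 14 ℕ.≤? k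
  ... | yes _    = refl
  ... | no  14≰k = contradiction 14≤k 14≰k

  triangleBound-pos : ∀ k → 0 ℕ.< triangleBound k
  triangleBound-pos zero    = s≤s z≤n
  triangleBound-pos (suc k) = s≤s z≤n

  double-bound : ∀ k r a → 2 ℕ.* r ℕ.< a → 2 ℕ.* (r ℕ.* triangleBound k) ℕ.< a ℕ.* triangleBound k
  double-bound k r a 2r<a =
    subst (ℕ._< a ℕ.* triangleBound k) (ℕ.*-assoc 2 r (triangleBound k))
      (ℕ.*-monoˡ-< (triangleBound k) {{ℕ.>-nonZero (triangleBound-pos k)}} 2r<a)

  half-bounds : ∀ d → ⌊ d /2⌋ ℕ.+ ⌊ d /2⌋ ℕ.≤ d × d ℕ.≤ suc (⌊ d /2⌋ ℕ.+ ⌊ d /2⌋)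
  half-bounds zero = z≤n , z≤n
  half-bounds (suc zero) = z≤n , s≤s z≤n
  half-bounds (suc (suc d)) with le , ge ← half-bounds d =
    subst (ℕ._≤ suc (suc d)) step (s≤s (s≤s le)) , subst (λ m → suc (suc d) ℕ.≤ suc m) step (s≤s (s≤s ge))
    where
    step = cong suc (sym (ℕ.+-suc ⌊ d /2⌋ ⌊ d /2⌋))

  -- With δ = `slack`, this is (1 + δ(k)) (k - 1) k! Σ_{j ≤ k} 1/j!.
  ramseyBound : ℕ → ℕ
  ramseyBound k = suc (slack k) ℕ.* (k ∸ 1) ℕ.* triangleBound k

  ramseyGraph-at-bound : ∀ k → 2 ℕ.≤ k → RamseyGraph k (ramseyBound k)
  ramseyGraph-at-bound (suc zero) (s≤s ())
  ramseyGraph-at-bound k@(suc (suc k′)) 2≤k with 14 ℕ.≤? k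
  ... | yes 14≤k = ramseyGraph-bound r (subst (λ k → 2 ℕ.* k ℕ.≤ r ℕ.* r) 14+d≡k 2k≤r²)
                     (double-bound k r (1 ℕ.* (k ∸ 1)) (subst (λ k → 2 ℕ.* r ℕ.< 1 ℕ.* (k ∸ 1)) 14+d≡k 2r<k-1))
    where
    d = k ∸ 14
    h = ⌊ d /2⌋
    -- This is ⌊k/2⌋ - 1, the largest r with 2r ≤ k - 2. For k = 13 it would be 5, and 25 < 26 = 2k.
    r = 6 ℕ.+ h
    14+d≡k : 14 ℕ.+ d ≡ k
    14+d≡k = ℕ.m+[n∸m]≡n 14≤k
    2k≤r² : 2 ℕ.* (14 ℕ.+ d) ℕ.≤ r ℕ.* r
    2k≤r² = begin
      2 ℕ.* (14 ℕ.+ d)                                              ≤⟨ ℕ.*-monoʳ-≤ 2 (ℕ.+-monoʳ-≤ 14 (proj₂ (half-bounds d))) ⟩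
      2 ℕ.* (14 ℕ.+ suc (h ℕ.+ h))                                  ≤⟨ ℕ.m≤m+n _ (6 ℕ.+ 8 ℕ.* h ℕ.+ h ℕ.* h) ⟩
      2 ℕ.* (14 ℕ.+ suc (h ℕ.+ h)) ℕ.+ (6 ℕ.+ 8 ℕ.* h ℕ.+ h ℕ.* h)  ≡⟨ square h ⟩
      r ℕ.* r                                                       ∎
      where
      open ℕ.≤-Reasoning
      square : ∀ h → 2 ℕ.* (14 ℕ.+ suc (h ℕ.+ h)) ℕ.+ (6 ℕ.+ 8 ℕ.* h ℕ.+ h ℕ.* h) ≡ (6 ℕ.+ h) ℕ.* (6 ℕ.+ h)
      square = solve-∀
    2r<k-1 : 2 ℕ.* r ℕ.< 1 ℕ.* (13 ℕ.+ d)
    2r<k-1 = begin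
      suc (2 ℕ.* (6 ℕ.+ h))     ≡⟨ double h ⟩
      1 ℕ.* (13 ℕ.+ (h ℕ.+ h))  ≤⟨ ℕ.*-monoʳ-≤ 1 (ℕ.+-monoʳ-≤ 13 (proj₁ (half-bounds d))) ⟩
      1 ℕ.* (13 ℕ.+ d)          ∎
      where
      open ℕ.≤-Reasoning
      double : ∀ h → suc (2 ℕ.* (6 ℕ.+ h)) ≡ 1 ℕ.* (13 ℕ.+ (h ℕ.+ h))
      double = solve-∀
  -- For small k, r = k parts suffice: 2k ≤ k^2, and 2k < 5 (k - 1) already at k = 2, which is why
  -- `slack` is 4 here.
  ... | no _ = ramseyGraph-bound k (ℕ.*-monoˡ-≤ k 2≤k) (double-bound k k (5 ℕ.* (k ∸ 1))
                 (ℕ.≤-trans (ℕ.m≤m+n (suc (2 ℕ.* k)) (3 ℕ.* k′)) (ℕ.≤-reflexive (five k′))))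
    where
    five : ∀ k → suc (2 ℕ.* (2 ℕ.+ k)) ℕ.+ 3 ℕ.* k ≡ 5 ℕ.* suc k
    five = solve-∀

  -- `e-sum` increases, so the bound with the partial sum up to k passes to all m ≥ k and thereby to
  -- e. The term ε is simply added at the end.
  asymptotics : ∀ k n → n ℕ.≤ ramseyBound k →
                fromℕ n ≤lim λ m → e-sum m * (1ℚ + fromℕ (slack k)) * fromℕ ((k ∸ 1) ℕ.* k !)
  asymptotics k n n≤ ε 0<ε = k , λ m k≤m → begin
    fromℕ n                                          ≤⟨ fromℕ-mono n≤ ⟩
    fromℕ (s ℕ.* (k ∸ 1) ℕ.* triangleBound k)        ≡⟨ fromℕ-* (s ℕ.* (k ∸ 1)) (triangleBound k) ⟩
    fromℕ (s ℕ.* (k ∸ 1)) * fromℕ (triangleBound k)  ≡⟨ cong (fromℕ (s ℕ.* (k ∸ 1)) *_) (e-sum*k!≡triangleBound k) ⟨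
    fromℕ (s ℕ.* (k ∸ 1)) * (e-sum k * fromℕ (k !))  ≡⟨ *-assoc (fromℕ (s ℕ.* (k ∸ 1))) (e-sum k) (fromℕ (k !)) ⟨
    fromℕ (s ℕ.* (k ∸ 1)) * e-sum k * fromℕ (k !)    ≡⟨ cong (_* fromℕ (k !)) (*-comm (fromℕ (s ℕ.* (k ∸ 1))) (e-sum k)) ⟩
    e-sum k * fromℕ (s ℕ.* (k ∸ 1)) * fromℕ (k !)    ≡⟨ *-assoc (e-sum k) (fromℕ (s ℕ.* (k ∸ 1))) (fromℕ (k !)) ⟩
    e-sum k * (fromℕ (s ℕ.* (k ∸ 1)) * fromℕ (k !))  ≡⟨ cong (e-sum k *_) (fromℕ-* (s ℕ.* (k ∸ 1)) (k !)) ⟨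
    e-sum k * fromℕ (s ℕ.* (k ∸ 1) ℕ.* k !)          ≡⟨ cong (λ a → e-sum k * fromℕ a) (ℕ.*-assoc s (k ∸ 1) (k !)) ⟩
    e-sum k * fromℕ (s ℕ.* N)                        ≤⟨ *-monoʳ-≤-nonNeg (fromℕ (s ℕ.* N)) {{fromℕ-nonNeg (s ℕ.* N)}} (e-mono m k≤m) ⟩
    e-sum m * fromℕ (s ℕ.* N)                        ≡⟨ cong (e-sum m *_) (fromℕ-* s N) ⟩
    e-sum m * (fromℕ s * fromℕ N)                    ≡⟨ *-assoc (e-sum m) (fromℕ s) (fromℕ N) ⟨
    e-sum m * fromℕ s * fromℕ N                      ≡⟨ cong (λ q → e-sum m * q * fromℕ N) (fromℕ-+ 1 (slack k)) ⟩
    e-sum m * (1ℚ + fromℕ (slack k)) * fromℕ N       ≤⟨ p≤p+q _ ε {{nonNegative (<⇒≤ 0<ε)}} ⟩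
    e-sum m * (1ℚ + fromℕ (slack k)) * fromℕ N + ε   ∎
    where
    open ≤-Reasoning
    s = suc (slack k)
    N = (k ∸ 1) ℕ.* k !
    e-mono : ∀ m → k ℕ.≤ m → e-sum k ≤ e-sum m
    e-mono m k≤m = subst (λ m → e-sum k ≤ e-sum m) (ℕ.m∸n+n≡m k≤m) (e-sum-mono (m ∸ k))

  slack-littleO : IsLittleO1 (fromℕ ∘ slack)
  slack-littleO ε 0<ε = 14 , λ k 14≤k → subst (λ s → ∣ fromℕ s ∣ < ε) (sym (slack-large 14≤k)) 0<ε

  abstract
    -- The search for the least n ends at the bound already proved. The result is kept opaque, so
    -- that the search is never evaluated.
    ramseyGraphNumber : ∀ k → ∃[ n ] IsLeast (RamseyGraph (suc (suc k))) n
    ramseyGraphNumber k = ∃-least (ramseyGraph? (suc (suc k))) (ramseyGraph-at-bound (suc (suc k)) (s≤s (s≤s z≤n)))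

    ramseyBergeNumber : ∀ k → ∃[ n ] IsLeast (RamseyBerge (suc (suc k))) n
    ramseyBergeNumber k = ∃-least (ramseyBerge? (suc (suc k)))
      (ramseyGraph⇒ramseyBerge (proj₁ (proj₂ (ramseyGraphNumber k))))

-- The Ramsey numbers as functions of k, and the theorem.

open Configurations
open LowerBound using (lowerBound)
open Asymptotics
open import Data.Integer.Base using (+_)
open import Data.Nat.Base using (zero; suc; s≤s) renaming (_^_ to _^ℕ_)
open import Data.Nat.Base using (ℕ; _!; _∸_) renaming (_≤_ to _≤ℕ_; _+_ to _+ℕ_; _*_ to _*ℕ_)
open import Data.Nat.Properties using (+-identityʳ; +-comm)
open import Data.Product.Base using (Σ-syntax; _×_; _,_; proj₁; proj₂)
open import Data.Rational.Base using (ℚ; 0ℚ; 1ℚ; _<_; _+_; _*_; _/_)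
open import Data.Rational.Properties using (positive⁻¹)
open import Function.Base using (_∘_)
open import Relation.Binary.PropositionalEquality using (sym; subst)

-- The value 0 for k < 2 is a filler; the claims concern k ≥ 2.
R₃ R : ℕ → ℕ
R₃ (suc (suc k)) = proj₁ (ramseyBergeNumber k)
R₃ _             = 0
R  (suc (suc k)) = proj₁ (ramseyGraphNumber k)
R  _             = 0

isRamsey : ∀ k → 2 ≤ℕ k → IsR₃ (Berge K₄) k (R₃ k) × IsR K₄⋆ k (R k)
isRamsey (suc zero)    (s≤s ())
isRamsey (suc (suc k)) _ =
  leastRamseyBerge⇒IsR₃ (proj₂ (ramseyBergeNumber k)) , leastRamseyGraph⇒IsR (proj₂ (ramseyGraphNumber k))

R₃-bounds : ∀ k → 2 ≤ℕ k → 2^[ + 1 / 9 · k ]≤ (R₃ k) × R₃ k ≤ℕ R k +ℕ 1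
R₃-bounds (suc zero)    (s≤s ())
R₃-bounds (suc (suc k)) _ =
  -- For c = 1/9 the exponent 1 · k on the left reduces to k + 0, and the power on the right is the
  -- ninth.
  subst (λ m → 2 ^ℕ m ≤ℕ R₃ (suc (suc k)) ^ℕ 9) (sym (+-identityʳ (suc (suc k))))
    (lowerBound (proj₁ (proj₂ (ramseyBergeNumber k)))) ,
  -- Minimality of `R₃`: one vertex more than `R` is enough for a Berge copy of K₄.
  subst (R₃ (suc (suc k)) ≤ℕ_) (+-comm 1 (R (suc (suc k))))
    (proj₂ (proj₂ (ramseyBergeNumber k)) _ (ramseyGraph⇒ramseyBerge (proj₁ (proj₂ (ramseyGraphNumber k)))))

R-bound : ∀ k → 2 ≤ℕ k → R k ≤ℕ ramseyBound k
R-bound (suc zero)        (s≤s ())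
R-bound k@(suc (suc k′)) 2≤k = proj₂ (proj₂ (ramseyGraphNumber k′)) _ (ramseyGraph-at-bound k 2≤k)

theorem4 : Σ[ R₃ ∈ (ℕ → ℕ) ] Σ[ R ∈ (ℕ → ℕ) ]
    (∀ k → 2 ≤ℕ k → IsR₃ (Berge K₄) k (R₃ k) × IsR K₄⋆ k (R k)) ×
    (Σ[ c ∈ ℚ ] 0ℚ < c ×
    (∀ k → 2 ≤ℕ k → 2^[ c · k ]≤ (R₃ k) × R₃ k ≤ℕ R k +ℕ 1)) ×
    (Σ[ δ ∈ (ℕ → ℚ) ] IsLittleO1 δ ×
    (∀ k → 2 ≤ℕ k → fromℕ (R k) ≤lim λ m → e-sum m * (1ℚ + δ k) * fromℕ ((k ∸ 1) *ℕ k !)))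
theorem4 =
  R₃ , R , isRamsey ,
  (+ 1 / 9 , positive⁻¹ (+ 1 / 9) , R₃-bounds) ,
  (fromℕ ∘ slack , slack-littleO , λ k 2≤k → asymptotics k (R k) (R-bound k 2≤k))
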